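{- Let $r\ge 2$ be an integer and let $S_0^r\in\{0,1\}^{3\times4\times1\times\cdots\times1}$ be the $r$-dimensional 0--1 matrix whose last $r-2$ dimensions have width 1 and whose entries are given by the $3\times 4$ matrix $$S_0=\begin{pmatrix}1&0&1&0\\1&0&0&1\\0&1&0&1\end{pmatrix}.$$ Then the vertex-ordered $r$-uniform hypergraph $H(S_0^r)$ is a forest with interval chromatic number $r$, and $$\mathrm{Ex}_<^r(H(S_0^r),n)=\Omega\big(n^{r-1}2^{\sqrt{\log n}-O(\log\log n)}\big)\quad\text{as } n\to\infty .$$ Consequently, for every $r\ge2$ it is false that for every $r$-uniform vertex-ordered forest $F$ with interval chromatic number $r$ there is a constant $c(F)$ with $\mathrm{Ex}_<^r(F,n)=O(n^{r-1}\log^{c(F)}n)$.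
   Context: $\log$ is the binary logarithm. A vertex-ordered hypergraph is a hypergraph with a linear order on its vertex set. For an $r$-uniform vertex-ordered hypergraph $H$, $\mathrm{Ex}_<^r(H,n)$ is the maximum number of edges in an $r$-uniform vertex-ordered hypergraph on $n$ vertices not containing any subgraph order-isomorphic to $H$ (isomorphic via an order-preserving bijection of vertices). The interval chromatic number $\chi_<(H)$ is the smallest number of intervals (with respect to the order on $V(H)$) that $V(H)$ can be partitioned into such that each hyperedge intersects $r$ distinct intervals. A hypergraph is a forest if its edges can be ordered $e_1,\dots,e_{|E|}$ so that for all $i<|E|$ there exists $h>i$ with $e_i\cap\bigcup_{j>i}e_j\subseteq e_h$. For an $r$-dimensional 0--1 matrix $P\in\{0,1\}^{k_1\times\cdots\times k_r}$, $H(P)$ is the vertex-ordered $r$-uniform hypergraph with $k_1+\cdots+k_r$ vertices $i^{(j)}$ ($1\le j\le r$, $1\le i\le k_j$), ordered primarily by the axis $j$ and then by the coordinate $i$ within the axis, having one hyperedge $\{i_1^{(1)},\dots,i_r^{(r)}\}$ for each entry $P(i_1,\dots,i_r)=1$. -}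

module Defs where

open import Data.Bool using (Bool; true; false; T?) renaming (_≟_ to _≟ᵇ_)
open import Data.Fin as Fin using (Fin; zero; suc; finToFun; funToFin)
import Data.Fin.Properties as Fin
open import Data.Fin.Subset as Subset using (Subset; ∣_∣; ⁅_⁆; _∩_; ⋃)
import Data.Fin.Subset.Properties as Subset
open import Data.List as List
  using (List; []; _∷_; [_]; map; filter; length; allFin; cartesianProductWith)
open import Data.List.Extrema.Nat using (max; xs≤max; argmax-sel)
import Data.List.Properties as List
open import Data.List.Membership.Propositional using (_∈_)
open import Data.List.Membership.Propositional.Properties
  using ( ∈-map⁺; ∈-map⁻; ∈-filter⁺; ∈-filter⁻; ∈-++⁺ˡ; ∈-++⁺ʳ; ∈-++⁻; ∈-∃++
        ; ∈-cartesianProductWith⁺; ∈-allFin)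
import Data.List.Membership.DecPropositional as DecMembership
open import Data.List.Relation.Binary.Permutation.Propositional using (_↭_)
open import Data.List.Relation.Unary.All as All using (All; []; _∷_)
import Data.List.Relation.Unary.All.Properties as All
open import Data.List.Relation.Unary.AllPairs using ([]; _∷_)
open import Data.List.Relation.Unary.Any using (Any; here; there)
open import Data.List.Relation.Unary.Unique.Propositional using (Unique)
import Data.List.Relation.Unary.Unique.Propositional.Properties as Unique
open import Data.Nat using (ℕ; zero; suc; _+_; _*_; _^_; _≤_; _<_; z≤n; s≤s; _≟_)
import Data.Nat.Properties as ℕ
open import Data.Product using (∃-syntax; Σ-syntax; _×_; _,_; proj₁; proj₂)
open import Data.Sum using (_⊎_; inj₁; inj₂)
open import Data.Vec using (Vec; []; _∷_; sum; replicate; lookup; tabulate; _++_)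
import Data.Vec.Properties as Vec
open import Data.Vec.Relation.Unary.All using ([]; _∷_) renaming (All to AllV)
open import Function using (_∘_; id)
open import Function.Definitions using (Surjective)
open import Relation.Binary.Core using (_Preserves_⟶_)
open import Relation.Binary.PropositionalEquality
  using (_≡_; _≗_; refl; sym; trans; cong; cong₂; subst; subst₂)
open import Relation.Nullary using (¬_; Dec; does; yes; no; contradiction)
open import Relation.Nullary.Decidable using (_×-dec_; _→-dec_; ¬?; map′; does-⇔)
open import Function.Bundles using (mk⇔)

private
  variable
    r v n : ℕ

-- A finite vertex-ordered hypergraph is, up to order-isomorphism, one whose
-- vertex set is Fin v with its usual order.  Edges form a set: the order in
-- which they are listed carries no information.
record Hypergraph (r v : ℕ) : Set where
  field
    edges   : List (Subset v)
    unique  : Unique edges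
    uniform : All (λ e → ∣ e ∣ ≡ r) edges

open Hypergraph public

image : (Fin v → Fin n) → Subset v → Subset n
image φ e = tabulate λ y → does (Fin.any? λ x → (x Subset.∈? e) ×-dec (φ x Fin.≟ y))

-- Some subgraph of the graph with edge list `gs` is order-isomorphic to the
-- graph with edge list `hs`; φ is the isomorphism, followed by the inclusion.
_⊑_ : List (Subset v) → List (Subset n) → Set
_⊑_ {v} {n} hs gs =
  Σ[ φ ∈ (Fin v → Fin n) ]
    (φ Preserves Fin._<_ ⟶ Fin._<_) × All (λ e → image φ e ∈ gs) hs

_Contains_ : Hypergraph r n → Hypergraph r v → Set
G Contains H = edges H ⊑ edges G

_⊑?_ : (hs : List (Subset v)) (gs : List (Subset n)) → Dec (hs ⊑ gs)
_⊑?_ {v} {n} hs gs = map′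
  (λ (k , mono , hs⊆) → finToFun k , (λ {i} {j} → mono i j) , hs⊆)
  (λ (φ , mono , hs⊆) → funToFin φ ,
    transport (sym ∘ Fin.finToFun-funToFin φ) (λ i j i<j → mono i<j) hs⊆)
  (Fin.any? λ k → good? (finToFun k))
  where
  Good : (Fin v → Fin n) → Set
  Good φ = (∀ i j → i Fin.< j → φ i Fin.< φ j) × All (λ e → image φ e ∈ gs) hs

  good? : ∀ φ → Dec (Good φ)
  good? φ = (Fin.all? λ i → Fin.all? λ j → (i Fin.<? j) →-dec (φ i Fin.<? φ j))
            ×-dec All.all? (λ e → DecMembership._∈?_ (Vec.≡-dec _≟ᵇ_) (image φ e) gs) hs

  image-cong : ∀ {φ ψ : Fin v → Fin n} → φ ≗ ψ → ∀ e → image φ e ≡ image ψ e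
  image-cong {φ} {ψ} eq e = Vec.tabulate-cong λ y → does-⇔
    (mk⇔ (λ (x , x∈e , p) → x , x∈e , trans (sym (eq x)) p)
         (λ (x , x∈e , p) → x , x∈e , trans (eq x) p))
    (Fin.any? λ x → (x Subset.∈? e) ×-dec (φ x Fin.≟ y))
    (Fin.any? λ x → (x Subset.∈? e) ×-dec (ψ x Fin.≟ y))

  transport : ∀ {φ ψ : Fin v → Fin n} → φ ≗ ψ →
    (∀ i j → i Fin.< j → φ i Fin.< φ j) → All (λ e → image φ e ∈ gs) hs → Good ψ
  transport eq mono hs⊆ =
    (λ i j i<j → subst₂ Fin._<_ (eq i) (eq j) (mono i j i<j)) ,
    All.map (λ {e} → subst (_∈ gs) (image-cong eq e)) hs⊆

subsets : ∀ n → List (Subset n)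
subsets zero    = [ [] ]
subsets (suc n) = cartesianProductWith _∷_ (true ∷ false ∷ []) (subsets n)

subsetsOfSize : (r n : ℕ) → List (Subset n)
subsetsOfSize r n = filter (λ e → ∣ e ∣ ≟ r) (subsets n)

sublists : {A : Set} → List A → List (List A)
sublists []       = [ [] ]
sublists (x ∷ xs) = map (x ∷_) (sublists xs) List.++ sublists xs

-- Edge lists of the r-uniform hypergraphs on Fin n not containing H, each edge
-- set being listed exactly once.
avoiders : Hypergraph r v → (n : ℕ) → List (List (Subset n))
avoiders {r} H n = filter (λ gs → ¬? (edges H ⊑? gs)) (sublists (subsetsOfSize r n))

-- The maximum over the empty set (which occurs only when H has no edges and
-- at most n vertices) is taken to be 0.  `Ex-upper` and `Ex-attained` below
-- characterise this function.
Ex : Hypergraph r v → ℕ → ℕ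
Ex H n = max 0 (map length (avoiders H n))

-- e₁, …, eₘ such that every eᵢ with i < m has some h > i with
-- eᵢ ∩ ⋃_{j>i} eⱼ ⊆ eₕ.
data ForestOrdering {v} : List (Subset v) → Set where
  []  : ForestOrdering []
  [-] : ∀ {e} → ForestOrdering [ e ]
  _∷_ : ∀ {e es} → Any (λ h → (e ∩ ⋃ es) Subset.⊆ h) es →
        ForestOrdering es → ForestOrdering (e ∷ es)

IsForest : Hypergraph r v → Set
IsForest H = ∃[ es ] (es ↭ edges H) × ForestOrdering es

-- A partition of the vertices into m (nonempty) intervals, given by the map
-- sending each vertex to the number of its interval.
IntervalColourable : Hypergraph r v → ℕ → Set
IntervalColourable {r} {v} H m =
  Σ[ c ∈ (Fin v → Fin m) ]
    (c Preserves Fin._≤_ ⟶ Fin._≤_) × Surjective _≡_ _≡_ c ×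
    All (λ e → ∣ image c e ∣ ≡ r) (edges H)

HasIntervalChromaticNumber : Hypergraph r v → ℕ → Set
HasIntervalChromaticNumber H m =
  IntervalColourable H m × (∀ m′ → IntervalColourable H m′ → m ≤ m′)

-- The entry at (i₁ , … , iᵣ) has index i₁ ∷ … ∷ iᵣ ∷ [].
Matrix : Vec ℕ r → Set
Matrix ks = AllV Fin ks → Bool

indices : (ks : Vec ℕ r) → List (AllV Fin ks)
indices []       = [ [] ]
indices (k ∷ ks) = cartesianProductWith _∷_ (allFin k) (indices ks)

-- The vertex set Fin (sum ks) is the concatenation of one block of size kⱼ per
-- axis j; the vertex i^(j) is the i-th element of block j.  So the hyperedge
-- {i₁^(1), …, iᵣ^(r)} is a concatenation of singletons.
hyperedge : {ks : Vec ℕ r} → AllV Fin ks → Subset (sum ks)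
hyperedge []       = []
hyperedge (i ∷ is) = ⁅ i ⁆ ++ hyperedge is

private
  ∣++∣ : ∀ {m n} (s : Subset m) (t : Subset n) → ∣ s ++ t ∣ ≡ ∣ s ∣ + ∣ t ∣
  ∣++∣ []          t = refl
  ∣++∣ (true ∷ s)  t = cong suc (∣++∣ s t)
  ∣++∣ (false ∷ s) t = ∣++∣ s t

  ⁅⁆-injective : {i j : Fin n} → ⁅ i ⁆ ≡ ⁅ j ⁆ → i ≡ j
  ⁅⁆-injective {i = i} {j} eq =
    Subset.x∈⁅y⁆⇒x≡y j (subst (i Subset.∈_) eq (Subset.x∈⁅x⁆ i))

  ∷-injective : ∀ {k} {ks : Vec ℕ r} {i j : Fin k} {is js : AllV Fin ks} →
                _≡_ {A = AllV Fin (k ∷ ks)} (i ∷ is) (j ∷ js) → i ≡ j × is ≡ js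
  ∷-injective refl = refl , refl

∣hyperedge∣ : {ks : Vec ℕ r} (is : AllV Fin ks) → ∣ hyperedge is ∣ ≡ r
∣hyperedge∣ []       = refl
∣hyperedge∣ (i ∷ is) = trans (∣++∣ ⁅ i ⁆ (hyperedge is))
  (cong₂ _+_ (Subset.∣⁅x⁆∣≡1 i) (∣hyperedge∣ is))

hyperedge-injective : {ks : Vec ℕ r} {is js : AllV Fin ks} →
                      hyperedge is ≡ hyperedge js → is ≡ js
hyperedge-injective {is = []}     {[]}     _  = refl
hyperedge-injective {is = i ∷ is} {j ∷ js} eq
  with p , q ← Vec.++-injective ⁅ i ⁆ ⁅ j ⁆ eq =
  cong₂ _∷_ (⁅⁆-injective p) (hyperedge-injective q)

indices-unique : (ks : Vec ℕ r) → Unique (indices ks)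
indices-unique []       = [] ∷ []
indices-unique (k ∷ ks) = Unique.cartesianProductWith⁺ _∷_ ∷-injective
  (Unique.allFin⁺ k) (indices-unique ks)

∈-indices : {ks : Vec ℕ r} (is : AllV Fin ks) → is ∈ indices ks
∈-indices []       = here refl
∈-indices (i ∷ is) = ∈-cartesianProductWith⁺ _∷_ (∈-allFin i) (∈-indices is)

matrixHypergraph : {ks : Vec ℕ r} → Matrix ks → Hypergraph r (sum ks)
matrixHypergraph {ks = ks} P = record
  { edges   = map hyperedge ones
  ; unique  = Unique.map⁺ hyperedge-injective
                (Unique.filter⁺ (T? ∘ P) (indices-unique ks))
  ; uniform = All.map⁺ (All.universal ∣hyperedge∣ ones)
  }
  where ones = filter (T? ∘ P) (indices ks)

S₀ : Vec (Vec Bool 4) 3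
S₀ = (true  ∷ false ∷ true  ∷ false ∷ [])
   ∷ (true  ∷ false ∷ false ∷ true  ∷ [])
   ∷ (false ∷ true  ∷ false ∷ true  ∷ [])
   ∷ []

-- S₀^r for r = 2 + m.
S₀^[2+_] : (m : ℕ) → Matrix (3 ∷ 4 ∷ replicate m 1)
S₀^[2+ m ] (i ∷ j ∷ _) = lookup (lookup S₀ i) j

-- Real numbers enter only through their rational approximations:
-- p/q ≤ √(log₂ n) iff p² ≤ q² log₂ n, for q > 0.
_/_≤√log₂_ : ℕ → ℕ → ℕ → Set
p / q ≤√log₂ n = 2 ^ (p * p) ≤ n ^ (q * q)

-- log₂ n ≤ a/b, for b > 0.
log₂_≤_/_ : ℕ → ℕ → ℕ → Set
log₂ n ≤ a / b = n ^ b ≤ 2 ^ a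

-- f(n) = Ω(n^k 2^(√(log n) - O(log log n))): there are C, d and N such that
--   n^k 2^√(log n) ≤ d (log n)^C f(n)   for all n ≥ N,
-- since 2^(C log log n) = (log n)^C.  As t ↦ 2^t and t ↦ t^C are continuous
-- and nondecreasing, this holds iff
--   n^k 2^(p/q) ≤ d (a/b)^C f(n)   whenever p/q ≤ √(log n) and log n ≤ a/b,
-- which is written with denominators cleared and both sides raised to the
-- power q.
Ω[n^_·2^√log-O[loglog]] : ℕ → (ℕ → ℕ) → Set
Ω[n^ k ·2^√log-O[loglog]] f =
  ∃[ C ] ∃[ d ] ∃[ N ] 0 < d × (∀ n → N ≤ n →
    ∀ p q a b → 0 < q → 0 < b → p / q ≤√log₂ n → log₂ n ≤ a / b →
      2 ^ p * (n ^ k * b ^ C) ^ q ≤ (d * a ^ C * f n) ^ q)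

-- f(n) = O(n^k log^c n), i.e. f(n) ≤ K n^k (a/b)^c whenever log n ≤ a/b, for
-- large n.  An existentially quantified real exponent c may be rounded up to a
-- natural number, as log n ≥ 1 for n ≥ 2; similarly for K.
O[n^_·log^_] : ℕ → ℕ → (ℕ → ℕ) → Set
O[n^ k ·log^ c ] f =
  ∃[ K ] ∃[ N ] (∀ n → N ≤ n →
    ∀ a b → 0 < b → log₂ n ≤ a / b →
      f n * b ^ c ≤ K * n ^ k * a ^ c)

private
  _∈?ˢ_ : (e : Subset n) (es : List (Subset n)) → Dec (e ∈ es)
  _∈?ˢ_ = DecMembership._∈?_ (Vec.≡-dec _≟ᵇ_)

  filter∈sublists : {A : Set} {P : A → Set} (P? : ∀ x → Dec (P x)) →
                    ∀ xs → filter P? xs ∈ sublists xs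
  filter∈sublists P? []       = here refl
  filter∈sublists P? (x ∷ xs) with P? x
  ... | yes _ = ∈-++⁺ˡ (∈-map⁺ (x ∷_) (filter∈sublists P? xs))
  ... | no  _ = ∈-++⁺ʳ _ (filter∈sublists P? xs)

  sublists-All : {A : Set} {P : A → Set} → ∀ {xs ys} →
                 ys ∈ sublists xs → All P xs → All P ys
  sublists-All {xs = []}     (here refl) []         = []
  sublists-All {xs = x ∷ xs} ys∈         (px ∷ pxs)
    with ∈-++⁻ (map (x ∷_) (sublists xs)) ys∈
  ... | inj₂ p = sublists-All p pxs
  ... | inj₁ p with zs , zs∈ , refl ← ∈-map⁻ (x ∷_) p = px ∷ sublists-All zs∈ pxs

  sublists-Unique : {A : Set} → ∀ {xs ys : List A} →
                    ys ∈ sublists xs → Unique xs → Unique ys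
  sublists-Unique {xs = []}     (here refl) []         = []
  sublists-Unique {xs = x ∷ xs} ys∈         (px ∷ pxs)
    with ∈-++⁻ (map (x ∷_) (sublists xs)) ys∈
  ... | inj₂ p = sublists-Unique p pxs
  ... | inj₁ p with zs , zs∈ , refl ← ∈-map⁻ (x ∷_) p =
    sublists-All zs∈ px ∷ sublists-Unique zs∈ pxs

  length-mono : {A : Set} {xs ys : List A} → Unique xs →
                (∀ {x} → x ∈ xs → x ∈ ys) → length xs ≤ length ys
  length-mono {xs = []}     _          _   = z≤n
  length-mono {xs = x ∷ xs} (x∉ ∷ xs!) xs⊆
    with as , bs , refl ← ∈-∃++ (xs⊆ (here refl)) = begin
    suc (length xs)               ≤⟨ s≤s (length-mono xs! sub) ⟩
    suc (length (as List.++ bs))  ≡⟨ cong suc (List.length-++ as) ⟩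
    suc (length as + length bs)   ≡⟨ ℕ.+-suc (length as) (length bs) ⟨
    length as + length (x ∷ bs)   ≡⟨ List.length-++ as ⟨
    length (as List.++ x ∷ bs)    ∎
    where
    open ℕ.≤-Reasoning
    sub : ∀ {y} → y ∈ xs → y ∈ as List.++ bs
    sub y∈ with ∈-++⁻ as (xs⊆ (there y∈))
    ... | inj₁ p           = ∈-++⁺ˡ p
    ... | inj₂ (here refl) = contradiction refl (All.lookup x∉ y∈)
    ... | inj₂ (there p)   = ∈-++⁺ʳ as p

∈-subsets : (s : Subset n) → s ∈ subsets n
∈-subsets []          = here refl
∈-subsets (true  ∷ s) = ∈-cartesianProductWith⁺ _∷_ {xs = true ∷ false ∷ []} (here refl) (∈-subsets s)
∈-subsets (false ∷ s) = ∈-cartesianProductWith⁺ _∷_ {xs = true ∷ false ∷ []} (there (here refl)) (∈-subsets s)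

subsets-unique : ∀ n → Unique (subsets n)
subsets-unique zero    = [] ∷ []
subsets-unique (suc n) = Unique.cartesianProductWith⁺ _∷_ Vec.∷-injective
  (((λ ()) ∷ []) ∷ [] ∷ []) (subsets-unique n)

Ex-upper : (H : Hypergraph r v) (G : Hypergraph r n) →
           ¬ (G Contains H) → length (edges G) ≤ Ex H n
Ex-upper {r} {n = n} H G free = ℕ.≤-trans
  (length-mono (unique G) ⊆gs)
  (All.lookup (xs≤max 0 (map length (avoiders H n))) (∈-map⁺ length
    (∈-filter⁺ (λ gs → ¬? (edges H ⊑? gs))
      (filter∈sublists (_∈?ˢ edges G) (subsetsOfSize r n)) gs-free)))
  where
  gs = filter (_∈?ˢ edges G) (subsetsOfSize r n)

  ⊆gs : ∀ {e} → e ∈ edges G → e ∈ gs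
  ⊆gs {e} e∈ = ∈-filter⁺ (_∈?ˢ edges G)
    (∈-filter⁺ (λ e → ∣ e ∣ ≟ r) (∈-subsets e) (All.lookup (uniform G) e∈)) e∈

  gs-free : ¬ (edges H ⊑ gs)
  gs-free (φ , mono , hs⊆) = free (φ , mono ,
    All.map (proj₂ ∘ ∈-filter⁻ (_∈?ˢ edges G) {xs = subsetsOfSize r n}) hs⊆)

Ex-attained : (H : Hypergraph r v) → 0 < Ex H n →
              Σ[ G ∈ Hypergraph r n ] ¬ (G Contains H) × length (edges G) ≡ Ex H n
Ex-attained {r} {n = n} H 0<ex
  with argmax-sel id 0 (map length (avoiders H n))
... | inj₁ ex≡0 = contradiction (subst (0 <_) ex≡0 0<ex) λ ()
... | inj₂ ex∈ with gs , gs∈ , eq ← ∈-map⁻ length ex∈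
  with gs∈′ , free ← ∈-filter⁻ (λ gs → ¬? (edges H ⊑? gs)) {xs = sublists (subsetsOfSize r n)} gs∈ =
  record
    { edges   = gs
    ; unique  = sublists-Unique gs∈′ (Unique.filter⁺ (λ e → ∣ e ∣ ≟ r) (subsets-unique n))
    ; uniform = sublists-All gs∈′ (All.all-filter (λ e → ∣ e ∣ ≟ r) (subsets n))
    } , free , sym eq

{-# OPTIONS --safe #-}
module Submission where

-- Columns are vectors of l digits, each in {left, right} × [B], below a free
-- leading digit, in lexicographic order.  For every level k < K pair the left
-- digit x with the right digit x + k; these matchings partition the columns
-- into combinatorial cubes.  The rows are all these cubes, sorted by level
-- first, so every column lies in exactly K rows.  In a copy of S₀ consecutive
-- rows share a column, hence their levels satisfy k₁ < k₂ < k₃.  At the leading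
-- digit where the columns y₁ and y₄ differ, y₁ is left and y₄ = y₁ + k₂ right.
-- If y₂ is left, its partner y₄ gives y₂ + k₃ = y₁ + k₂, so y₂ < y₁; if y₂ is
-- right, it agrees with y₄, hence so does y₃, and k₁ = k₂.  Both are absurd.
-- With K = 2^l and B of order l 2^l there are about n = (2B)^l rows and columns
-- and of order n 2^l ones, and log n = l² (1 + O(log l / l)).

open import Defs
open import Data.Bool using (T; T?; true; false)
open import Data.Empty using (⊥)
open import Data.Fin as Fin using (Fin; toℕ; fromℕ<; inject≤; splitAt; _↑ˡ_; _↑ʳ_)
import Data.Fin.Properties as Fin
open import Data.Fin.Subset as Subset using (Subset; ∣_∣; ⁅_⁆; _⊆_; _∩_)
import Data.Fin.Subset.Properties as Subset
open import Data.List as List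
  using (List; []; _∷_; [_]; map; length; allFin; cartesianProduct; cartesianProductWith)
import Data.List.Properties as List
open import Data.List.Membership.Propositional using (_∈_)
open import Data.List.Membership.Propositional.Properties
  using (∈-map⁺; ∈-map⁻; ∈-filter⁺; ∈-cartesianProductWith⁻)
open import Data.List.Relation.Binary.Permutation.Propositional using (_↭_; ↭-refl; prep; swap)
open import Data.List.Relation.Unary.All as All using (All; []; _∷_)
import Data.List.Relation.Unary.All.Properties as All
open import Data.List.Relation.Unary.Any using (here)
open import Data.List.Relation.Unary.Unique.Propositional using (Unique)
import Data.List.Relation.Unary.Unique.Propositional.Properties as Unique
open import Data.Nat
  using ( ℕ; zero; suc; _+_; _*_; _∸_; _^_; _≤_; _<_; z≤n; s≤s; _<?_; _≤?_
        ; NonZero; >-nonZero; >-nonZero⁻¹)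
open import Data.Nat.DivMod
open import Data.Nat.Properties
open import Data.Nat.Tactic.RingSolver using (solve-∀)
open import Data.Product using (∃-syntax; _×_; _,_; proj₁; proj₂)
open import Data.Sum using (_⊎_; inj₁; inj₂)
open import Data.Vec using (Vec; []; _∷_; _++_; sum; replicate)
import Data.Vec.Properties as Vec
open import Data.Vec.Relation.Unary.All using ([]; _∷_) renaming (All to AllV)
open import Function using (_∘_; id)
open import Relation.Binary.Core using (_Preserves_⟶_)
open import Relation.Binary.PropositionalEquality
  using (_≡_; refl; sym; trans; cong; cong₂; subst; subst₂; module ≡-Reasoning)
open import Relation.Nullary using (¬_; does; yes; no; contradiction)
open import Relation.Nullary.Decidable using (_×-dec_; dec-true)

private variable
  m n r v j₁ j₂ k₁ k₂ : ℕ

-- Partitions of the columns into cubes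

-- Reducing modulo `W` recovers the low digit. The encoding is used twice: to append a digit to the
-- number of a cube, and to number a row by its level and its cube.
digits-injective : ∀ {W} a a′ {c c′} → c < W → c′ < W →
                   a * W + c ≡ a′ * W + c′ → a ≡ a′ × c ≡ c′
digits-injective {W} a a′ {c} {c′} c<W c′<W eq =
  *-cancelʳ-≡ a a′ W (+-cancelʳ-≡ c′ (a * W) (a′ * W) (subst (λ z → a * W + z ≡ a′ * W + c′) c≡c′ eq)) , c≡c′
  where
  instance W≢0 = >-nonZero (≤-<-trans z≤n c<W)

  low : ∀ b {d} → d < W → (b * W + d) % W ≡ d
  low b {d} d<W = begin
    (b * W + d) % W  ≡⟨ cong (_% W) (+-comm (b * W) d) ⟩
    (d + b * W) % W  ≡⟨ [m+kn]%n≡m%n d b W ⟩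
    d % W            ≡⟨ m<n⇒m%n≡m d<W ⟩
    d                ∎
    where open ≡-Reasoning

  c≡c′ : c ≡ c′
  c≡c′ = trans (sym (low a c<W)) (trans (cong (_% W) eq) (low a′ c′<W))

digits-bound : ∀ {W a n c} → a < n → c < W → a * W + c < n * W
digits-bound {W} {a} {n} {c} a<n c<W = begin-strict
  a * W + c  <⟨ +-monoʳ-< (a * W) c<W ⟩
  a * W + W  ≡⟨ +-comm (a * W) W ⟩
  suc a * W  ≤⟨ *-monoˡ-≤ W a<n ⟩
  n * W      ∎
  where open ≤-Reasoning

leading-digit-mono : ∀ {W} a a′ {c c′} → c′ < W → a * W + c ≤ a′ * W + c′ → a ≤ a′
leading-digit-mono a a′ {c} c′<W le = ≮⇒≥ λ a′<a →
  <⇒≱ (digits-bound a′<a c′<W) (≤-trans (m≤m+n _ c) le)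

quotient-remainder-unique : ∀ {x y} d .{{_ : NonZero d}} → x / d ≡ y / d → x % d ≡ y % d → x ≡ y
quotient-remainder-unique {x} {y} d p q = begin
  x                  ≡⟨ m≡m%n+[m/n]*n x d ⟩
  x % d + x / d * d  ≡⟨ cong₂ (λ u v → u + v * d) q p ⟩
  y % d + y / d * d  ≡⟨ m≡m%n+[m/n]*n y d ⟨
  y                  ∎
  where open ≡-Reasoning

remainder-mono : ∀ {x y} d .{{_ : NonZero d}} → x / d ≡ y / d → x ≤ y → x % d ≤ y % d
remainder-mono {x} {y} d p x≤y = +-cancelʳ-≤ (x / d * d) (x % d) (y % d) (begin
  x % d + x / d * d  ≡⟨ m≡m%n+[m/n]*n x d ⟨
  x                  ≤⟨ x≤y ⟩
  y                  ≡⟨ m≡m%n+[m/n]*n y d ⟩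
  y % d + y / d * d  ≡⟨ cong (λ z → y % d + z * d) p ⟨
  y % d + x / d * d  ∎)
  where open ≤-Reasoning

module Cubes (B K : ℕ) .{{B≢0 : NonZero B}} where

  W : ℕ
  W = B + K

  instance
    2B≢0 : NonZero (2 * B)
    2B≢0 = m*n≢0 2 B

  -- A digit x below `B` is left, and `B + x` is the right digit x. The value names a class of the
  -- matching at level `k`: left x and right x + k both give x + k, and unmatched digits are alone
  -- in their class. For `k` below `K` all values lie below `W`.
  digit : ℕ → ℕ → ℕ
  digit k x with x <? B
  ... | yes _ = x + k
  ... | no  _ = x ∸ B

  -- The argument `l` counts the digits of `y` in base `2 * B` that are matched; the quotient left
  -- at the end is the free leading digit. Two columns lie in the same cube of level `k` exactly
  -- when these numbers agree, provided `k` is below `K`.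
  cube : ℕ → ℕ → ℕ → ℕ
  cube zero    k y = y
  cube (suc l) k y = cube l k (y / (2 * B)) * W + digit k (y % (2 * B))

  digit<W : ∀ {k x} → k < K → x < 2 * B → digit k x < W
  digit<W {k} {x} k<K x<2B with x <? B
  ... | yes x<B = +-mono-< x<B k<K
  ... | no  x≮B = begin-strict
    x ∸ B                <⟨ ∸-monoˡ-< x<2B (≮⇒≥ x≮B) ⟩
    B + (B + 0) ∸ B      ≡⟨ m+n∸m≡n B (B + 0) ⟩
    B + 0                ≤⟨ +-monoʳ-≤ B z≤n ⟩
    W                    ∎
    where open ≤-Reasoning

  cube-bound : ∀ l {Q k y} → k < K → y < Q * (2 * B) ^ l → cube l k y < Q * W ^ l
  cube-bound zero    k<K y< = y<
  cube-bound (suc l) {Q} {k} {y} k<K y< = begin-strict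
    cube l k (y / (2 * B)) * W + digit k (y % (2 * B))
      <⟨ digits-bound (cube-bound l {Q} k<K (m<n*o⇒m/o<n y<′)) (digit<W k<K (m%n<n y (2 * B))) ⟩
    Q * W ^ l * W    ≡⟨ *-assoc Q (W ^ l) W ⟩
    Q * (W ^ l * W)  ≡⟨ cong (Q *_) (*-comm (W ^ l) W) ⟩
    Q * W ^ suc l    ∎
    where
    open ≤-Reasoning
    y<′ : y < Q * (2 * B) ^ l * (2 * B)
    y<′ = subst (y <_) (trans (cong (Q *_) (*-comm (2 * B) _)) (sym (*-assoc Q _ (2 * B)))) y<

  digit-collapse : ∀ {k₁ k₂ k₃ x₁ x₂ x₃ x₄} → k₁ < k₂ → k₂ < k₃ →
    x₁ ≤ x₂ → x₂ ≤ x₃ → x₃ ≤ x₄ →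
    digit k₁ x₁ ≡ digit k₁ x₃ → digit k₂ x₁ ≡ digit k₂ x₄ → digit k₃ x₂ ≡ digit k₃ x₄ →
    x₁ ≡ x₄
  digit-collapse {k₁} {k₂} {k₃} {x₁} {x₂} {x₃} {x₄} k₁<k₂ k₂<k₃ x₁≤x₂ x₂≤x₃ x₃≤x₄ eq₁ eq₂ eq₃
    with x₁ <? B | x₄ <? B
  -- A matching has at most one digit of each side in a class, so on a common side `eq₂` suffices.
  ... | yes _ | yes _ = +-cancelʳ-≡ k₂ x₁ x₄ eq₂
  ... | no x₁≮B | no x₄≮B = ∸-cancelʳ-≡ (≮⇒≥ x₁≮B) (≮⇒≥ x₄≮B) eq₂
  ... | no x₁≮B | yes x₄<B = contradiction (≤-<-trans (≤-trans x₁≤x₂ (≤-trans x₂≤x₃ x₃≤x₄)) x₄<B) x₁≮B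
  ... | yes x₁<B | no x₄≮B with x₂ <? B
  -- Both x₁ at level k₂ and x₂ at level k₃ are matched with x₄, so x₁ + k₂ = x₂ + k₃, against x₁ ≤
  -- x₂ and k₂ < k₃.
  ...   | yes _ = contradiction (trans eq₂ (sym eq₃)) (<⇒≢ (+-mono-≤-< x₁≤x₂ k₂<k₃))
  ...   | no x₂≮B with x₃ <? B
  ...     | yes x₃<B = contradiction (≤-<-trans x₂≤x₃ x₃<B) x₂≮B
  ...     | no _ = contradiction (+-cancelˡ-≡ x₁ k₁ k₂ (begin
              x₁ + k₁  ≡⟨ eq₁ ⟩
              x₃ ∸ B   ≡⟨ cong (_∸ B) x₃≡x₄ ⟩
              x₄ ∸ B   ≡⟨ eq₂ ⟨
              x₁ + k₂  ∎)) (<⇒≢ k₁<k₂)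
    where
    open ≡-Reasoning
    x₃≡x₄ : x₃ ≡ x₄
    x₃≡x₄ = ≤-antisym x₃≤x₄
      (≤-trans (≤-reflexive (sym (∸-cancelʳ-≡ (≮⇒≥ x₂≮B) (≮⇒≥ x₄≮B) eq₃))) x₂≤x₃)

  -- Induction from the leading digit down. The hypotheses pass to the quotients, so the first and
  -- last quotients agree, and the two between them are squeezed. Then the last digits inherit the
  -- order of the columns and `digit-collapse` applies. The inequalities are weak because the
  -- quotients may coincide.
  cube-collapse : ∀ l {k₁ k₂ k₃ y₁ y₂ y₃ y₄} → k₁ < k₂ → k₂ < k₃ → k₃ < K →
    y₁ ≤ y₂ → y₂ ≤ y₃ → y₃ ≤ y₄ →
    cube l k₁ y₁ ≡ cube l k₁ y₃ → cube l k₂ y₁ ≡ cube l k₂ y₄ → cube l k₃ y₂ ≡ cube l k₃ y₄ →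
    y₁ ≡ y₄
  cube-collapse zero    _ _ _ _ _ _ _ eq₂ _ = eq₂
  cube-collapse (suc l) {k₁} {k₂} {k₃} {y₁} {y₂} {y₃} {y₄} k₁<k₂ k₂<k₃ k₃<K y₁≤y₂ y₂≤y₃ y₃≤y₄ eq₁ eq₂ eq₃ =
    quotient-remainder-unique D q₁≡q₄
      (digit-collapse k₁<k₂ k₂<k₃
        (remainder-mono D q₁≡q₂ y₁≤y₂)
        (remainder-mono D q₂≡q₃ y₂≤y₃)
        (remainder-mono D q₃≡q₄ y₃≤y₄)
        (proj₂ (split k₁<K eq₁)) (proj₂ (split k₂<K eq₂)) (proj₂ (split k₃<K eq₃)))
    where
    D = 2 * B
    k₂<K = <-trans k₂<k₃ k₃<K
    k₁<K = <-trans k₁<k₂ k₂<K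

    split : ∀ {k y y′} → k < K → cube (suc l) k y ≡ cube (suc l) k y′ →
      cube l k (y / D) ≡ cube l k (y′ / D) × digit k (y % D) ≡ digit k (y′ % D)
    split {y = y} {y′} k<K = digits-injective _ _ (digit<W k<K (m%n<n y D)) (digit<W k<K (m%n<n y′ D))

    q₁≤q₂ = /-monoˡ-≤ D y₁≤y₂
    q₂≤q₃ = /-monoˡ-≤ D y₂≤y₃
    q₃≤q₄ = /-monoˡ-≤ D y₃≤y₄

    q₁≡q₄ : y₁ / D ≡ y₄ / D
    q₁≡q₄ = cube-collapse l k₁<k₂ k₂<k₃ k₃<K q₁≤q₂ q₂≤q₃ q₃≤q₄
      (proj₁ (split k₁<K eq₁)) (proj₁ (split k₂<K eq₂)) (proj₁ (split k₃<K eq₃))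

    q₁≡q₂ : y₁ / D ≡ y₂ / D
    q₁≡q₂ = ≤-antisym q₁≤q₂ (≤-trans (≤-trans q₂≤q₃ q₃≤q₄) (≤-reflexive (sym q₁≡q₄)))

    q₃≡q₄ : y₃ / D ≡ y₄ / D
    q₃≡q₄ = ≤-antisym q₃≤q₄ (≤-trans (≤-reflexive (sym q₁≡q₄)) (≤-trans q₁≤q₂ q₂≤q₃))

    q₂≡q₃ : y₂ / D ≡ y₃ / D
    q₂≡q₃ = ≤-antisym q₂≤q₃ (≤-trans q₃≤q₄ (≤-trans (≤-reflexive (sym q₁≡q₄)) q₁≤q₂))

-- Matrix hypergraphs and interval colourings

∈-++⁺ˡ : {p : Subset m} (q : Subset n) {x : Fin m} → x Subset.∈ p → x ↑ˡ n Subset.∈ (p ++ q)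
∈-++⁺ˡ {p = p} q {x} x∈p = Vec.lookup⇒[]= _ (p ++ q)
  (trans (Vec.lookup-++ˡ p q x) (Vec.[]=⇒lookup x∈p))

∈-++⁺ʳ : (p : Subset m) {q : Subset n} {x : Fin n} → x Subset.∈ q → m ↑ʳ x Subset.∈ (p ++ q)
∈-++⁺ʳ p {q} {x} x∈q = Vec.lookup⇒[]= _ (p ++ q)
  (trans (Vec.lookup-++ʳ p q x) (Vec.[]=⇒lookup x∈q))

∈-++⁻ : (p : Subset m) (q : Subset n) {x : Fin (m + n)} → x Subset.∈ (p ++ q) →
        (∃[ y ] x ≡ y ↑ˡ n × y Subset.∈ p) ⊎ (∃[ y ] x ≡ m ↑ʳ y × y Subset.∈ q)
∈-++⁻ {m} {n} p q {x} x∈ with splitAt m x in eq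
... | inj₁ y with refl ← Fin.splitAt⁻¹-↑ˡ {m} {n} {x} eq =
  inj₁ (y , refl , Vec.lookup⇒[]= y p (trans (sym (Vec.lookup-++ˡ p q y)) (Vec.[]=⇒lookup x∈)))
... | inj₂ y with refl ← Fin.splitAt⁻¹-↑ʳ {m} {n} {x} eq =
  inj₂ (y , refl , Vec.lookup⇒[]= y q (trans (sym (Vec.lookup-++ʳ p q y)) (Vec.[]=⇒lookup x∈)))

∈-image⁺ : (φ : Fin v → Fin n) {e : Subset v} {x : Fin v} → x Subset.∈ e → φ x Subset.∈ image φ e
∈-image⁺ φ {e} {x} x∈e = Vec.lookup⇒[]= (φ x) (image φ e)
  (trans (Vec.lookup∘tabulate _ (φ x))
    (dec-true (Fin.any? λ u → (u Subset.∈? e) ×-dec (φ u Fin.≟ φ x)) (x , x∈e , refl)))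

∈-image⁻ : (φ : Fin v → Fin n) {e : Subset v} {y : Fin n} → y Subset.∈ image φ e →
           ∃[ x ] x Subset.∈ e × φ x ≡ y
∈-image⁻ φ {e} {y} y∈ with Fin.any? (λ u → (u Subset.∈? e) ×-dec (φ u Fin.≟ y)) in eq
... | yes p = p
... | no ¬p = contradiction
  (trans (sym (Vec.[]=⇒lookup y∈)) (trans (Vec.lookup∘tabulate _ y) (cong does eq))) λ ()

block : (ks : Vec ℕ r) → Fin (sum ks) → Fin r
block (k ∷ ks) x with splitAt k x
... | inj₁ _ = Fin.zero
... | inj₂ y = Fin.suc (block ks y)

block-mono : (ks : Vec ℕ r) {x y : Fin (sum ks)} → x Fin.≤ y → block ks x Fin.≤ block ks y
block-mono (k ∷ ks) {x} {y} x≤y with splitAt k x in p | splitAt k y in q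
... | inj₁ _ | _ = z≤n
... | inj₂ x′ | inj₁ y′
  with refl ← Fin.splitAt⁻¹-↑ʳ {k} {_} {x} p | refl ← Fin.splitAt⁻¹-↑ˡ {k} {_} {y} q =
  contradiction (begin-strict
    toℕ y′                 <⟨ Fin.toℕ<n y′ ⟩
    k                      ≤⟨ m≤m+n k _ ⟩
    k + toℕ x′             ≡⟨ Fin.toℕ-↑ʳ k x′ ⟨
    toℕ (k ↑ʳ x′)          ≤⟨ x≤y ⟩
    toℕ (y′ ↑ˡ sum ks)     ≡⟨ Fin.toℕ-↑ˡ y′ (sum ks) ⟩
    toℕ y′                 ∎) (<-irrefl refl)
  where open ≤-Reasoning
... | inj₂ x′ | inj₂ y′
  with refl ← Fin.splitAt⁻¹-↑ʳ {k} {_} {x} p | refl ← Fin.splitAt⁻¹-↑ʳ {k} {_} {y} q =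
  s≤s (block-mono ks (+-cancelˡ-≤ k _ _ (subst₂ _≤_ (Fin.toℕ-↑ʳ k x′) (Fin.toℕ-↑ʳ k y′) x≤y)))

hyperedge-meets-block : {ks : Vec ℕ r} (is : AllV Fin ks) (j : Fin r) →
                        ∃[ x ] x Subset.∈ hyperedge is × block ks x ≡ j
hyperedge-meets-block {ks = k ∷ ks} (i ∷ is) Fin.zero =
  i ↑ˡ sum ks , ∈-++⁺ˡ (hyperedge is) (Subset.x∈⁅x⁆ i) , lemma
  where
  lemma : block (k ∷ ks) (i ↑ˡ sum ks) ≡ Fin.zero
  lemma rewrite Fin.splitAt-↑ˡ k i (sum ks) = refl
hyperedge-meets-block {ks = k ∷ ks} (i ∷ is) (Fin.suc j)
  with x , x∈ , eq ← hyperedge-meets-block is j =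
  k ↑ʳ x , ∈-++⁺ʳ ⁅ i ⁆ x∈ , lemma
  where
  lemma : block (k ∷ ks) (k ↑ʳ x) ≡ Fin.suc j
  lemma rewrite Fin.splitAt-↑ʳ k (sum ks) x = cong Fin.suc eq

∣image-block∣ : {ks : Vec ℕ r} (is : AllV Fin ks) → ∣ image (block ks) (hyperedge is) ∣ ≡ r
∣image-block∣ {r} {ks} is = trans (cong ∣_∣ image≡⊤) (Subset.∣⊤∣≡n r)
  where
  image≡⊤ : image (block ks) (hyperedge is) ≡ Subset.⊤
  image≡⊤ = Subset.⊆-antisym Subset.⊆⊤ λ {j} _ →
    let x , x∈ , eq = hyperedge-meets-block is j
    in subst (Subset._∈ image (block ks) (hyperedge is)) eq (∈-image⁺ (block ks) x∈)

-- The axes serve as the intervals, since a hyperedge has one vertex on each axis. Conversely, the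
-- colours on a single edge already number r. The entry `is` supplies that edge and shows that no
-- axis is empty.
matrixHypergraph-intervalChromatic : {ks : Vec ℕ r} (P : Matrix ks) (is : AllV Fin ks) → P is ≡ true →
  HasIntervalChromaticNumber (matrixHypergraph P) r
matrixHypergraph-intervalChromatic {r} {ks} P is Pis =
  (block ks , block-mono ks , surjective , All.map⁺ (All.universal ∣image-block∣ _)) , minimal
  where
  surjective : ∀ j → ∃[ x ] (∀ {z} → z ≡ x → block ks z ≡ j)
  surjective j = let x , _ , eq = hyperedge-meets-block is j in x , λ { refl → eq }

  minimal : ∀ m′ → IntervalColourable (matrixHypergraph P) m′ → r ≤ m′
  minimal m′ (c , _ , _ , rainbow) = subst (_≤ m′)
    (All.lookup rainbow (∈-map⁺ hyperedge (∈-filter⁺ (T? ∘ P) (∈-indices is) (subst T (sym Pis) _))))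
    (Subset.∣p∣≤n (image c (hyperedge is)))

-- The hypergraph of the pattern

origin : ∀ m → AllV Fin (replicate m 1)
origin zero    = []
origin (suc m) = Fin.zero ∷ origin m

indices-replicate-1 : ∀ m → indices (replicate m 1) ≡ [ origin m ]
indices-replicate-1 zero    = refl
indices-replicate-1 (suc m) rewrite indices-replicate-1 m = refl

entry : ∀ m → Fin 3 → Fin 4 → Subset (sum (3 ∷ 4 ∷ replicate m 1))
entry m i j = hyperedge {ks = 3 ∷ 4 ∷ replicate m 1} (i ∷ j ∷ origin m)

pattern #0 = Fin.zero
pattern #1 = Fin.suc Fin.zero
pattern #2 = Fin.suc (Fin.suc Fin.zero)
pattern #3 = Fin.suc (Fin.suc (Fin.suc Fin.zero))

-- Axes of width 1 contribute the single index `origin m`; after this rewriting the list of ones is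
-- found by computation.
edges-S₀ : ∀ m → edges (matrixHypergraph S₀^[2+ m ]) ≡
  entry m #0 #0 ∷ entry m #0 #2 ∷ entry m #1 #0 ∷ entry m #1 #3 ∷ entry m #2 #1 ∷ entry m #2 #3 ∷ []
edges-S₀ m rewrite indices-replicate-1 m = refl

-- Apart from the vertices of `origin m`, which lie in every edge, the ones of S₀ form a path:
-- consecutive edges share a row and a column alternately. Each edge therefore meets the later ones
-- only inside its successor.
S₀-forest : ∀ m → IsForest (matrixHypergraph S₀^[2+ m ])
S₀-forest m = path , subst (path ↭_) (sym (edges-S₀ m)) path↭edges , forest
  where
  e = entry m
  path = e #0 #2 ∷ e #0 #0 ∷ e #1 #0 ∷ e #1 #3 ∷ e #2 #3 ∷ e #2 #1 ∷ []

  path↭edges : path ↭ e #0 #0 ∷ e #0 #2 ∷ e #1 #0 ∷ e #1 #3 ∷ e #2 #1 ∷ e #2 #3 ∷ []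
  path↭edges = swap _ _ (prep _ (prep _ (swap _ _ ↭-refl)))

  tail⊆ : (q : Subset (sum (replicate m 1))) → (hyperedge (origin m) ∩ q) ⊆ hyperedge (origin m)
  tail⊆ = Subset.p∩q⊆p _

  o : ∀ {n} {p q : Subset n} {s} → p ⊆ q → (false ∷ p) ⊆ (s ∷ q)
  o = Subset.out⊆

  i : ∀ {n} {p q : Subset n} → p ⊆ q → (true ∷ p) ⊆ (true ∷ q)
  i = Subset.in⊆in

  forest : ForestOrdering path
  forest =
      -- The letters run through the three row vertices and the four column vertices; the only `i`
      -- marks the one shared by an edge and its successor.
      here (i (o (o (o (o (o (o (tail⊆ _))))))))
    ∷ here (o (o (o (i (o (o (o (tail⊆ _))))))))
    ∷ here (o (i (o (o (o (o (o (tail⊆ _))))))))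
    ∷ here (o (o (o (o (o (o (i (tail⊆ _))))))))
    ∷ here (o (o (i (o (o (o (o (tail⊆ _))))))))
    ∷ [-]

-- Row and column vertices under increasing maps

module _ (k₁ k₂ : ℕ) (ks : Vec ℕ r) where

  rowVertex : Fin k₁ → Fin (sum (k₁ ∷ k₂ ∷ ks))
  rowVertex i = i ↑ˡ (k₂ + sum ks)

  colVertex : Fin k₂ → Fin (sum (k₁ ∷ k₂ ∷ ks))
  colVertex j = k₁ ↑ʳ (j ↑ˡ sum ks)

  toℕ-rowVertex : ∀ i → toℕ (rowVertex i) ≡ toℕ i
  toℕ-rowVertex i = Fin.toℕ-↑ˡ i (k₂ + sum ks)

  toℕ-colVertex : ∀ j → toℕ (colVertex j) ≡ k₁ + toℕ j
  toℕ-colVertex j = trans (Fin.toℕ-↑ʳ k₁ _) (cong (k₁ +_) (Fin.toℕ-↑ˡ j (sum ks)))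

  rowVertex-injective : ∀ {i i′} → rowVertex i ≡ rowVertex i′ → i ≡ i′
  rowVertex-injective = Fin.↑ˡ-injective _ _ _

  colVertex-injective : ∀ {j j′} → colVertex j ≡ colVertex j′ → j ≡ j′
  colVertex-injective = Fin.↑ˡ-injective _ _ _ ∘ Fin.↑ʳ-injective k₁ _ _

  rowVertex<colVertex : ∀ i j → rowVertex i Fin.< colVertex j
  rowVertex<colVertex i j = subst₂ _<_ (sym (toℕ-rowVertex i)) (sym (toℕ-colVertex j))
    (<-≤-trans (Fin.toℕ<n i) (m≤m+n k₁ (toℕ j)))

  rowVertex-mono-< : ∀ {i i′} → i Fin.< i′ → rowVertex i Fin.< rowVertex i′
  rowVertex-mono-< {i} {i′} = subst₂ _<_ (sym (toℕ-rowVertex i)) (sym (toℕ-rowVertex i′))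

  rowVertex-cancel-< : ∀ {i i′} → rowVertex i Fin.< rowVertex i′ → i Fin.< i′
  rowVertex-cancel-< {i} {i′} = subst₂ _<_ (toℕ-rowVertex i) (toℕ-rowVertex i′)

  colVertex-mono-< : ∀ {j j′} → j Fin.< j′ → colVertex j Fin.< colVertex j′
  colVertex-mono-< {j} {j′} lt = subst₂ _<_ (sym (toℕ-colVertex j)) (sym (toℕ-colVertex j′)) (+-monoʳ-< k₁ lt)

  colVertex-cancel-< : ∀ {j j′} → colVertex j Fin.< colVertex j′ → j Fin.< j′
  colVertex-cancel-< {j} {j′} lt =
    +-cancelˡ-< k₁ (toℕ j) (toℕ j′) (subst₂ _<_ (toℕ-colVertex j) (toℕ-colVertex j′) lt)

  module _ (i : Fin k₁) (j : Fin k₂) (is : AllV Fin ks) where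

    rowVertex∈hyperedge : rowVertex i Subset.∈ hyperedge (i ∷ j ∷ is)
    rowVertex∈hyperedge = ∈-++⁺ˡ (hyperedge (j ∷ is)) (Subset.x∈⁅x⁆ i)

    colVertex∈hyperedge : colVertex j Subset.∈ hyperedge (i ∷ j ∷ is)
    colVertex∈hyperedge = ∈-++⁺ʳ ⁅ i ⁆ (∈-++⁺ˡ (hyperedge is) (Subset.x∈⁅x⁆ j))

    ∈-hyperedge⁻ : ∀ {u} → u Subset.∈ hyperedge (i ∷ j ∷ is) → u ≡ rowVertex i ⊎ colVertex j Fin.≤ u
    ∈-hyperedge⁻ u∈ with ∈-++⁻ ⁅ i ⁆ (hyperedge (j ∷ is)) u∈
    ... | inj₁ (i′ , refl , i′∈) = inj₁ (cong rowVertex (Subset.x∈⁅y⁆⇒x≡y i i′∈))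
    ... | inj₂ (v , refl , v∈) with ∈-++⁻ ⁅ j ⁆ (hyperedge is) v∈
    ...   | inj₁ (j′ , refl , j′∈) = inj₂ (≤-reflexive (cong (toℕ ∘ colVertex) (sym (Subset.x∈⁅y⁆⇒x≡y j j′∈))))
    ...   | inj₂ (w , refl , _) = inj₂ (begin
      toℕ (colVertex j)          ≡⟨ toℕ-colVertex j ⟩
      k₁ + toℕ j                 ≤⟨ +-monoʳ-≤ k₁ (<⇒≤ (Fin.toℕ<n j)) ⟩
      k₁ + k₂                    ≤⟨ +-monoʳ-≤ k₁ (m≤m+n k₂ (toℕ w)) ⟩
      k₁ + (k₂ + toℕ w)          ≡⟨ cong (k₁ +_) (Fin.toℕ-↑ʳ k₂ w) ⟨
      k₁ + toℕ (k₂ ↑ʳ w)         ≡⟨ Fin.toℕ-↑ʳ k₁ (k₂ ↑ʳ w) ⟨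
      toℕ (k₁ ↑ʳ (k₂ ↑ʳ w))      ∎)
      where open ≤-Reasoning

-- An increasing map preserves the least and the second least element of an edge.
embedding-vertices : {js : Vec ℕ m} {ks : Vec ℕ r} {i : Fin j₁} {j : Fin j₂} {is : AllV Fin js}
  {x : Fin k₁} {y : Fin k₂} {zs : AllV Fin ks}
  (φ : Fin (sum (j₁ ∷ j₂ ∷ js)) → Fin (sum (k₁ ∷ k₂ ∷ ks))) → φ Preserves Fin._<_ ⟶ Fin._<_ →
  image φ (hyperedge (i ∷ j ∷ is)) ≡ hyperedge (x ∷ y ∷ zs) →
  φ (rowVertex j₁ j₂ js i) ≡ rowVertex k₁ k₂ ks x × φ (colVertex j₁ j₂ js j) ≡ colVertex k₁ k₂ ks y
embedding-vertices {j₁ = j₁} {j₂} {k₁} {k₂} {js = js} {ks} {i} {j} {is} {x} {y} {zs} φ mono eq = φrow , φcol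
  where
  f = hyperedge (x ∷ y ∷ zs)

  φ∈ : ∀ {u} → u Subset.∈ hyperedge (i ∷ j ∷ is) → φ u Subset.∈ f
  φ∈ = subst (_ Subset.∈_) eq ∘ ∈-image⁺ φ

  preimage : ∀ {w} → w Subset.∈ f → ∃[ u ] u Subset.∈ hyperedge (i ∷ j ∷ is) × φ u ≡ w
  preimage = ∈-image⁻ φ ∘ subst (_ Subset.∈_) (sym eq)

  -- If the preimage of the target's row vertex were a later vertex of the edge, the source's row
  -- vertex would be sent below the least element of `f`.
  φrow : φ (rowVertex j₁ j₂ js i) ≡ rowVertex k₁ k₂ ks x
  φrow with u , u∈ , φu≡ ← preimage (rowVertex∈hyperedge k₁ k₂ ks x y zs)
       with ∈-hyperedge⁻ j₁ j₂ js i j is u∈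
  ... | inj₁ refl = φu≡
  ... | inj₂ col≤u with ∈-hyperedge⁻ k₁ k₂ ks x y zs (φ∈ (rowVertex∈hyperedge j₁ j₂ js i j is))
  ...   | inj₁ φrow≡ = φrow≡
  ...   | inj₂ col≤ = contradiction (≤-<-trans col≤ (subst (φ (rowVertex j₁ j₂ js i) Fin.<_) φu≡
                        (mono (<-≤-trans (rowVertex<colVertex j₁ j₂ js i j) col≤u))))
                      (<-asym (rowVertex<colVertex k₁ k₂ ks x y))

  -- The least element of `f` is already taken by `φrow`, so the image of the column vertex is at
  -- least the target's column vertex. The preimage of the latter is not the row vertex either, and
  -- monotonicity gives the reverse inequality.
  φcol : φ (colVertex j₁ j₂ js j) ≡ colVertex k₁ k₂ ks y
  φcol with u , u∈ , φu≡ ← preimage (colVertex∈hyperedge k₁ k₂ ks x y zs)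
       with ∈-hyperedge⁻ j₁ j₂ js i j is u∈
  ... | inj₁ refl = contradiction (cong toℕ (trans (sym φrow) φu≡)) (<⇒≢ (rowVertex<colVertex k₁ k₂ ks x y))
  ... | inj₂ col≤u with ∈-hyperedge⁻ k₁ k₂ ks x y zs (φ∈ (colVertex∈hyperedge j₁ j₂ js i j is))
  ...   | inj₁ φcol≡ = contradiction (cong toℕ (trans φrow (sym φcol≡))) (<⇒≢ (mono (rowVertex<colVertex j₁ j₂ js i j)))
  ...   | inj₂ col≤ = Fin.≤-antisym (subst (φ (colVertex j₁ j₂ js j) Fin.≤_) φu≡ (mono-≤ col≤u)) col≤
    where
    mono-≤ : ∀ {u v} → u Fin.≤ v → φ u Fin.≤ φ v
    mono-≤ u≤v with m≤n⇒m<n∨m≡n u≤v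
    ... | inj₁ u<v = <⇒≤ (mono u<v)
    ... | inj₂ u≡v = ≤-reflexive (cong (toℕ ∘ φ) (Fin.toℕ-injective u≡v))

-- Hypergraphs from S₀-free matrices

S₀-Free : (Fin k₁ → Fin k₂ → Set) → Set
S₀-Free _∼_ = ∀ {x₁ x₂ x₃ y₁ y₂ y₃ y₄} →
  x₁ Fin.< x₂ → x₂ Fin.< x₃ → y₁ Fin.< y₂ → y₂ Fin.< y₃ → y₃ Fin.< y₄ →
  x₁ ∼ y₁ → x₁ ∼ y₃ → x₂ ∼ y₁ → x₂ ∼ y₄ → x₃ ∼ y₂ → x₃ ∼ y₄ → ⊥

length-cartesianProductWith : {A B C : Set} (f : A → B → C) (xs : List A) (ys : List B) →
  length (cartesianProductWith f xs ys) ≡ length xs * length ys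
length-cartesianProductWith f []       ys = refl
length-cartesianProductWith f (x ∷ xs) ys = trans (List.length-++ (map (f x) ys))
  (cong₂ _+_ (List.length-map (f x) ys) (length-cartesianProductWith f xs ys))

length-allFin : ∀ n → length (allFin n) ≡ n
length-allFin n = List.length-tabulate id

length-indices-replicate : ∀ m h → length (indices (replicate m h)) ≡ h ^ m
length-indices-replicate zero    h = refl
length-indices-replicate (suc m) h = trans
  (length-cartesianProductWith _∷_ (allFin h) (indices (replicate m h)))
  (cong₂ _*_ (length-allFin h) (length-indices-replicate m h))

∷-injective₃ : {ks : Vec ℕ r} {x x′ : Fin k₁} {y y′ : Fin k₂} {zs zs′ : AllV Fin ks} →
  _≡_ {A = AllV Fin (k₁ ∷ k₂ ∷ ks)} (x ∷ y ∷ zs) (x′ ∷ y′ ∷ zs′) → (x , y) ≡ (x′ , y′) × zs ≡ zs′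
∷-injective₃ refl = refl , refl

module Blowup {R C : ℕ} (ks : Vec ℕ m) (ps : List (Fin R × Fin C)) (ps! : Unique ps) where

  edge : Fin R × Fin C → AllV Fin ks → Subset (sum (R ∷ C ∷ ks))
  edge (x , y) zs = hyperedge (x ∷ y ∷ zs)

  -- Every one of the matrix is combined with all choices of coordinates on the other axes. A copy
  -- of the pattern hypergraph projects to a copy of S₀ on the first two axes, so freeness survives
  -- while the number of edges is multiplied.
  blowup : Hypergraph (2 + m) (sum (R ∷ C ∷ ks))
  blowup = record
    { edges   = cartesianProductWith edge ps (indices ks)
    ; unique  = Unique.cartesianProductWith⁺ edge (∷-injective₃ ∘ hyperedge-injective) ps! (indices-unique ks)
    ; uniform = All.tabulate λ e∈ →
        let (x , y) , zs , _ , _ , eq = ∈-cartesianProductWith⁻ edge ps (indices ks) e∈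
        in trans (cong Subset.∣_∣ eq) (∣hyperedge∣ (x ∷ y ∷ zs))
    }

  length-blowup : length (edges blowup) ≡ length ps * length (indices ks)
  length-blowup = length-cartesianProductWith edge ps (indices ks)

  module _ (φ : Fin (sum (3 ∷ 4 ∷ replicate m 1)) → Fin (sum (R ∷ C ∷ ks)))
           (mono : φ Preserves Fin._<_ ⟶ Fin._<_) where

    row : Fin 3 → Fin (sum (3 ∷ 4 ∷ replicate m 1))
    row = rowVertex 3 4 (replicate m 1)

    col : Fin 4 → Fin (sum (3 ∷ 4 ∷ replicate m 1))
    col = colVertex 3 4 (replicate m 1)

    ROW : Fin R → Fin (sum (R ∷ C ∷ ks))
    ROW = rowVertex R C ks

    COL : Fin C → Fin (sum (R ∷ C ∷ ks))
    COL = colVertex R C ks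

    Endpoints : Fin 3 → Fin 4 → Set
    Endpoints i j = ∃[ x ] ∃[ y ] φ (row i) ≡ ROW x × φ (col j) ≡ COL y × (x , y) ∈ ps

    endpoints : ∀ i j → image φ (entry m i j) ∈ edges blowup → Endpoints i j
    endpoints i j e∈ =
      let (x , y) , zs , xy∈ , _ , eq = ∈-cartesianProductWith⁻ edge ps (indices ks) e∈
          p , q = embedding-vertices {js = replicate m 1} {ks} {i} {j} {origin m} {x} {y} {zs} φ mono eq
      in x , y , p , q , xy∈

    sameRow : ∀ {u x x′} → u ≡ ROW x → u ≡ ROW x′ → x ≡ x′
    sameRow p p′ = rowVertex-injective R C ks (trans (sym p) p′)

    sameCol : ∀ {u y y′} → u ≡ COL y → u ≡ COL y′ → y ≡ y′
    sameCol q q′ = colVertex-injective R C ks (trans (sym q) q′)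

    rows : ∀ {i i′ x x′} → i Fin.< i′ → φ (row i) ≡ ROW x → φ (row i′) ≡ ROW x′ → x Fin.< x′
    rows i<i′ p p′ = rowVertex-cancel-< R C ks
      (subst₂ Fin._<_ p p′ (mono (rowVertex-mono-< 3 4 (replicate m 1) i<i′)))

    cols : ∀ {j j′ y y′} → j Fin.< j′ → φ (col j) ≡ COL y → φ (col j′) ≡ COL y′ → y Fin.< y′
    cols j<j′ q q′ = colVertex-cancel-< R C ks
      (subst₂ Fin._<_ q q′ (mono (colVertex-mono-< 3 4 (replicate m 1) j<j′)))

    endpoints⇒⊥ : S₀-Free (λ x y → (x , y) ∈ ps) →
      Endpoints #0 #0 → Endpoints #0 #2 → Endpoints #1 #0 →
      Endpoints #1 #3 → Endpoints #2 #1 → Endpoints #2 #3 → ⊥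
    endpoints⇒⊥ free
      (x₁ , y₁ , p₁  , q₁  , x₁∼y₁) (_  , y₃ , p₁′ , q₃  , x₁∼y₃)
      (x₂ , _  , p₂  , q₁′ , x₂∼y₁) (_  , y₄ , p₂′ , q₄  , x₂∼y₄)
      (x₃ , y₂ , p₃  , q₂  , x₃∼y₂) (_  , _  , p₃′ , q₄′ , x₃∼y₄)
      -- Edges in a common row or column of the pattern have the same image there, which reduces the
      -- twelve endpoints to three rows and four columns.
      with refl ← sameRow p₁ p₁′ | refl ← sameRow p₂ p₂′ | refl ← sameRow p₃ p₃′
         | refl ← sameCol q₁ q₁′ | refl ← sameCol q₄ q₄′ =
      free (rows {#0} {#1} (s≤s z≤n) p₁ p₂) (rows {#1} {#2} (s≤s (s≤s z≤n)) p₂ p₃)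
           (cols {#0} {#1} (s≤s z≤n) q₁ q₂) (cols {#1} {#2} (s≤s (s≤s z≤n)) q₂ q₃)
           (cols {#2} {#3} (s≤s (s≤s (s≤s z≤n))) q₃ q₄)
           x₁∼y₁ x₁∼y₃ x₂∼y₁ x₂∼y₄ x₃∼y₂ x₃∼y₄

  blowup-S₀-free : S₀-Free (λ x y → (x , y) ∈ ps) → ¬ (blowup Contains matrixHypergraph S₀^[2+ m ])
  blowup-S₀-free free (φ , mono , hs⊆)
    with e₁₁ ∷ e₁₃ ∷ e₂₁ ∷ e₂₄ ∷ e₃₂ ∷ e₃₄ ∷ [] ← subst (All (λ e → image φ e ∈ edges blowup)) (edges-S₀ m) hs⊆ =
    endpoints⇒⊥ φ mono free
      (endpoints φ mono #0 #0 e₁₁) (endpoints φ mono #0 #2 e₁₃) (endpoints φ mono #1 #0 e₂₁)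
      (endpoints φ mono #1 #3 e₂₄) (endpoints φ mono #2 #1 e₃₂) (endpoints φ mono #2 #3 e₃₄)

Ex-S₀-lower : ∀ {R C} (ks : Vec ℕ m) (ps : List (Fin R × Fin C)) → Unique ps →
  S₀-Free (λ x y → (x , y) ∈ ps) →
  length ps * length (indices ks) ≤ Ex (matrixHypergraph S₀^[2+ m ]) (sum (R ∷ C ∷ ks))
Ex-S₀-lower {m} ks ps ps! free = subst (_≤ _) length-blowup
  (Ex-upper (matrixHypergraph S₀^[2+ m ]) blowup (blowup-S₀-free free))
  where open Blowup ks ps ps!

-- The matrix with cubes as rows

module CubeMatrix (B K : ℕ) .{{_ : NonZero B}} (l Q R C : ℕ)
  (rows≤R : K * (Q * (B + K) ^ l) ≤ R) (cols≤C : Q * (2 * B) ^ l ≤ C) where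

  open Cubes B K

  N : ℕ
  N = Q * W ^ l

  Y : ℕ
  Y = Q * (2 * B) ^ l

  bound : (k : Fin K) (y : Fin Y) → cube l (toℕ k) (toℕ y) < N
  bound k y = cube-bound l {Q} (Fin.toℕ<n k) (Fin.toℕ<n y)

  row< : (k : Fin K) (y : Fin Y) → toℕ k * N + cube l (toℕ k) (toℕ y) < R
  row< k y = <-≤-trans (digits-bound (Fin.toℕ<n k) (bound k y)) rows≤R

  -- The level is the leading digit of the row number, which sorts the rows by level first.
  one : Fin K × Fin Y → Fin R × Fin C
  one (k , y) = fromℕ< (row< k y) , inject≤ y cols≤C

  one-injective : ∀ {p p′} → one p ≡ one p′ → p ≡ p′
  one-injective {k , y} {k′ , y′} eq = cong₂ _,_
    (Fin.toℕ-injective (proj₁ (digits-injective (toℕ k) (toℕ k′) (bound k y) (bound k′ y′)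
      (fromℕ<-injective′ (cong proj₁ eq)))))
    (Fin.inject≤-injective cols≤C cols≤C y y′ (cong proj₂ eq))
    where
    fromℕ<-injective′ : fromℕ< (row< k y) ≡ fromℕ< (row< k′ y′) → _
    fromℕ<-injective′ = Fin.fromℕ<-injective _ _ (row< k y) (row< k′ y′)

  ones : List (Fin R × Fin C)
  ones = map one (cartesianProduct (allFin K) (allFin Y))

  ones-unique : Unique ones
  ones-unique = Unique.map⁺ one-injective
    (Unique.cartesianProduct⁺ (Unique.allFin⁺ K) (Unique.allFin⁺ Y))

  length-ones : length ones ≡ K * Y
  length-ones = trans (List.length-map one (cartesianProduct (allFin K) (allFin Y)))
    (trans (length-cartesianProductWith _,_ (allFin K) (allFin Y))
      (cong₂ _*_ (length-allFin K) (length-allFin Y)))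

  -- The level and the cube as read off from the number of the row. The bounds make this reading
  -- unique, so the level belongs to the row and does not vary with the column.
  record Incidence (x : Fin R) (y : Fin C) : Set where
    field
      level   : ℕ
      level<K : level < K
      cube<N  : cube l level (toℕ y) < N
      row     : toℕ x ≡ level * N + cube l level (toℕ y)

  open Incidence

  ∈-ones⁻ : ∀ {x y} → (x , y) ∈ ones → Incidence x y
  ∈-ones⁻ xy∈ with (k , y) , _ , refl ← ∈-map⁻ one xy∈ = record
    { level   = toℕ k
    ; level<K = Fin.toℕ<n k
    ; cube<N  = subst (λ y′ → cube l (toℕ k) y′ < N) (sym y≡) (bound k y)
    ; row     = trans (Fin.toℕ-fromℕ< (row< k y))
                  (cong (λ y′ → toℕ k * N + cube l (toℕ k) y′) (sym y≡))
    }
    where y≡ = Fin.toℕ-inject≤ y cols≤C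

  level-unique : ∀ {x y y′} (e : Incidence x y) (e′ : Incidence x y′) →
    level e ≡ level e′ × cube l (level e) (toℕ y) ≡ cube l (level e′) (toℕ y′)
  level-unique e e′ = digits-injective (level e) (level e′) (cube<N e) (cube<N e′)
    (trans (sym (row e)) (row e′))

  same-cube : ∀ {x y y′} (e : Incidence x y) (e′ : Incidence x y′) →
    cube l (level e) (toℕ y) ≡ cube l (level e) (toℕ y′)
  same-cube {y′ = y′} e e′ with p , q ← level-unique e e′ =
    trans q (cong (λ k → cube l k (toℕ y′)) (sym p))

  -- Two rows of the same level which share a column coincide.
  level-mono-< : ∀ {x x′ y} → x Fin.< x′ → (e : Incidence x y) (e′ : Incidence x′ y) → level e < level e′
  level-mono-< {y = y} x<x′ e e′ = ≤∧≢⇒<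
    (leading-digit-mono (level e) (level e′) (cube<N e′) (<⇒≤ lt))
    λ eq → <⇒≢ lt (cong (λ k → k * N + cube l k (toℕ y)) eq)
    where lt = subst₂ _<_ (row e) (row e′) x<x′

  ones-S₀-free : S₀-Free (λ x y → (x , y) ∈ ones)
  ones-S₀-free x₁<x₂ x₂<x₃ y₁<y₂ y₂<y₃ y₃<y₄ m₁₁ m₁₃ m₂₁ m₂₄ m₃₂ m₃₄ =
    <⇒≢ (<-trans y₁<y₂ (<-trans y₂<y₃ y₃<y₄))
      (cube-collapse l k₁<k₂ k₂<k₃ (level<K e₃₄) (<⇒≤ y₁<y₂) (<⇒≤ y₂<y₃) (<⇒≤ y₃<y₄)
        (same-cube e₁₁ (∈-ones⁻ m₁₃))
        (same-cube e₂₁ e₂₄)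
        (sym (same-cube e₃₄ (∈-ones⁻ m₃₂))))
    where
    e₁₁ = ∈-ones⁻ m₁₁
    e₂₁ = ∈-ones⁻ m₂₁
    e₂₄ = ∈-ones⁻ m₂₄
    e₃₄ = ∈-ones⁻ m₃₄

    k₁<k₂ : level e₁₁ < level e₂₁
    k₁<k₂ = level-mono-< x₁<x₂ e₁₁ e₂₁

    -- The level of x₂ is read at y₁ in `e₂₁`, but the column shared with x₃ is y₄.
    k₂<k₃ : level e₂₁ < level e₃₄
    k₂<k₃ = subst (_< level e₃₄) (sym (proj₁ (level-unique e₂₁ e₂₄))) (level-mono-< x₂<x₃ e₂₄ e₃₄)

Ex-S₀-cubes : ∀ m l B K Q h R .{{_ : NonZero B}} →
  K * (Q * (B + K) ^ l) ≤ R → Q * (2 * B) ^ l ≤ h →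
  K * (Q * (2 * B) ^ l) * h ^ m ≤ Ex (matrixHypergraph S₀^[2+ m ]) (sum (R ∷ h ∷ replicate m h))
Ex-S₀-cubes m l B K Q h R rows≤R cols≤h = subst₂ (λ a b → a * b ≤ Ex (matrixHypergraph S₀^[2+ m ]) (sum (R ∷ h ∷ replicate m h)))
  length-ones (length-indices-replicate m h)
  (Ex-S₀-lower (replicate m h) ones ones-unique ones-S₀-free)
  where open CubeMatrix B K l Q R h rows≤R cols≤h

-- Asymptotics

n<2^n : ∀ n → n < 2 ^ n
n<2^n zero    = s≤s z≤n
n<2^n (suc n) = begin-strict
  suc n          ≤⟨ n<2^n n ⟩
  2 ^ n          <⟨ m<m+n (2 ^ n) (>-nonZero⁻¹ _ {{m^n≢0 2 n}}) ⟩
  2 ^ n + 2 ^ n  ≡⟨ cong (2 ^ n +_) (+-identityʳ (2 ^ n)) ⟨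
  2 ^ suc n      ∎
  where open ≤-Reasoning

2^-cancel-≤ : ∀ {m n} → 2 ^ m ≤ 2 ^ n → m ≤ n
2^-cancel-≤ le = ≮⇒≥ λ n<m → <⇒≱ (^-monoʳ-< 2 (s≤s (s≤s z≤n)) n<m) le

^-distribʳ-* : ∀ m n o → (m * n) ^ o ≡ m ^ o * n ^ o
^-distribʳ-* m n zero    = refl
^-distribʳ-* m n (suc o) = trans (cong (m * n *_) (^-distribʳ-* m n o)) (lemma m n (m ^ o) (n ^ o))
  where
  lemma : ∀ a b c d → a * b * (c * d) ≡ a * c * (b * d)
  lemma = solve-∀

-- Gives integer parts of log n and of √(log n), with g s equal to 2^s and to 2^(s²). The search
-- descends from s = n, where g (n + 1) exceeds n.
crossing : (g : ℕ → ℕ) → (∀ s → s < g s) → ∀ {n} → g 0 ≤ n → ∃[ s ] g s ≤ n × n < g (suc s)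
crossing g s<gs {n} g0≤n = search n (<-trans (n<1+n n) (s<gs (suc n)))
  where
  search : ∀ t → n < g (suc t) → ∃[ s ] g s ≤ n × n < g (suc s)
  search zero    n<g = 0 , g0≤n , n<g
  search (suc t) n<g with g (suc t) ≤? n
  ... | yes g≤n = suc t , g≤n , n<g
  ... | no  g≰n = search t (≰⇒> g≰n)

-- (1 - 1/(q+1))^l ≥ 1 - l/(q+1), multiplied by (q+1)^(l+1).
bernoulli : ∀ q l → suc q ^ l * suc q ≤ q ^ l * suc q + l * suc q ^ l
bernoulli q zero    = ≤-reflexive (sym (+-identityʳ _))
bernoulli q (suc l) = begin
  suc q * a * suc q                            ≡⟨ lemma₁ q a ⟩
  q * (a * suc q) + a * suc q                  ≤⟨ +-monoˡ-≤ (a * suc q) (*-monoʳ-≤ q (bernoulli q l)) ⟩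
  q * (b * suc q + l * a) + a * suc q          ≤⟨ m≤m+n _ (l * a) ⟩
  q * (b * suc q + l * a) + a * suc q + l * a  ≡⟨ lemma₂ q a b l ⟩
  q * b * suc q + suc l * (suc q * a)          ∎
  where
  open ≤-Reasoning
  a = suc q ^ l
  b = q ^ l

  lemma₁ : ∀ q a → suc q * a * suc q ≡ q * (a * suc q) + a * suc q
  lemma₁ = solve-∀

  lemma₂ : ∀ q a b l → q * (b * suc q + l * a) + a * suc q + l * a ≡ q * b * suc q + suc l * (suc q * a)
  lemma₂ = solve-∀

-- This is `bernoulli` at q = 1 + 2l, where the loss l/(q+1) is below 1/2. It dictates the ratio 1 +
-- 2l of `B` to `K` below: replacing B by B + K in all l digits then costs at most a factor 2.
bernoulli-half : ∀ l → (2 + 2 * l) ^ l ≤ 2 * (1 + 2 * l) ^ l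
bernoulli-half l = *-cancelˡ-≤ (2 + l) (begin
  (2 + l) * a              ≤⟨ +-cancelʳ-≤ (l * a) _ _ (subst (_≤ b * (2 + 2 * l) + l * a) (lemma₁ a l) (bernoulli (1 + 2 * l) l)) ⟩
  b * (2 + 2 * l)          ≤⟨ m≤m+n _ (2 * b) ⟩
  b * (2 + 2 * l) + 2 * b  ≡⟨ lemma₂ b l ⟩
  (2 + l) * (2 * b)        ∎)
  where
  open ≤-Reasoning
  a = (2 + 2 * l) ^ l
  b = (1 + 2 * l) ^ l

  lemma₁ : ∀ a l → a * (2 + 2 * l) ≡ (2 + l) * a + l * a
  lemma₁ = solve-∀

  lemma₂ : ∀ b l → b * (2 + 2 * l) + 2 * b ≡ (2 + l) * (2 * b)
  lemma₂ = solve-∀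

n≤2*[n/d]*d : ∀ n d .{{_ : NonZero d}} → 1 ≤ n / d → n ≤ 2 * (n / d * d)
n≤2*[n/d]*d n d 1≤n/d = begin
  n                          ≡⟨ m≡m%n+[m/n]*n n d ⟩
  n % d + n / d * d          ≤⟨ +-monoˡ-≤ (n / d * d) (m%n≤n n d) ⟩
  d + n / d * d              ≡⟨ cong (_+ n / d * d) (*-identityˡ d) ⟨
  1 * d + n / d * d          ≤⟨ +-monoˡ-≤ (n / d * d) (*-monoˡ-≤ d 1≤n/d) ⟩
  n / d * d + n / d * d      ≡⟨ cong (n / d * d +_) (+-identityʳ _) ⟨
  2 * (n / d * d)            ∎
  where open ≤-Reasoning

m*n≤o⇒m≤o/n : ∀ m n o .{{_ : NonZero n}} → m * n ≤ o → m ≤ o / n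
m*n≤o⇒m≤o/n m n o m*n≤o = subst (_≤ o / n) (m*n/n≡m m n) (/-monoˡ-≤ n m*n≤o)

-- With K = 2^l the K Q (B + K)^l rows number exactly Q M, where M = (2(B + K))^l, and by
-- `bernoulli-half` the columns number at least Q M / 2. Taking Q = ⌊h / M⌋ loses another factor 2,
-- hence the 4. Each column has K ones.
Ex-S₀-dense : ∀ m l h R → ((2 + 2 * l) * (2 * 2 ^ l)) ^ l ≤ h → h ≤ R →
  2 ^ l * h ^ (1 + m) ≤ 4 * Ex (matrixHypergraph S₀^[2+ m ]) (sum (R ∷ h ∷ replicate m h))
Ex-S₀-dense m l h R M≤h h≤R = begin
  K * (h * h ^ m)                        ≤⟨ *-monoʳ-≤ K (*-monoˡ-≤ (h ^ m) h≤4Y) ⟩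
  K * (4 * Y * h ^ m)                    ≡⟨ lemma K Y (h ^ m) ⟩
  4 * (K * Y * h ^ m)                    ≤⟨ *-monoʳ-≤ 4 (Ex-S₀-cubes m l B K Q h R rows≤R Y≤h) ⟩
  4 * Ex (matrixHypergraph S₀^[2+ m ]) (sum (R ∷ h ∷ replicate m h)) ∎
  where
  open ≤-Reasoning
  K = 2 ^ l
  B = (1 + 2 * l) * K
  M = ((2 + 2 * l) * (2 * K)) ^ l
  instance
    K≢0 : NonZero K
    K≢0 = m^n≢0 2 l
    B≢0 : NonZero B
    B≢0 = m*n≢0 (1 + 2 * l) K
    M≢0 : NonZero M
    M≢0 = m^n≢0 ((2 + 2 * l) * (2 * K)) l {{m*n≢0 (2 + 2 * l) (2 * K) {{_}} {{m*n≢0 2 K}}}}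
  Q = h / M
  Y = Q * (2 * B) ^ l

  lemma : ∀ K Y c → K * (4 * Y * c) ≡ 4 * (K * Y * c)
  lemma = solve-∀

  M≡ : M ≡ (2 * (B + K)) ^ l
  M≡ = cong (_^ l) (eq l K)
    where
    eq : ∀ l K → (2 + 2 * l) * (2 * K) ≡ 2 * ((1 + 2 * l) * K + K)
    eq = solve-∀

  rows≤R : K * (Q * (B + K) ^ l) ≤ R
  rows≤R = begin
    K * (Q * (B + K) ^ l)  ≡⟨ eq K Q ((B + K) ^ l) ⟩
    Q * (K * (B + K) ^ l)  ≡⟨ cong (Q *_) (^-distribʳ-* 2 (B + K) l) ⟨
    Q * (2 * (B + K)) ^ l  ≡⟨ cong (Q *_) M≡ ⟨
    Q * M                  ≤⟨ m/n*n≤m h M ⟩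
    h                      ≤⟨ h≤R ⟩
    R                      ∎
    where
    eq : ∀ a b c → a * (b * c) ≡ b * (a * c)
    eq = solve-∀

  Y≤h : Y ≤ h
  Y≤h = begin
    Q * (2 * B) ^ l        ≤⟨ *-monoʳ-≤ Q (^-monoˡ-≤ l (*-monoʳ-≤ 2 (m≤m+n B K))) ⟩
    Q * (2 * (B + K)) ^ l  ≡⟨ cong (Q *_) M≡ ⟨
    Q * M                  ≤⟨ m/n*n≤m h M ⟩
    h                      ∎

  M≤ : M ≤ 2 * (2 * B) ^ l
  M≤ = begin
    M                                      ≡⟨ ^-distribʳ-* (2 + 2 * l) (2 * K) l ⟩
    (2 + 2 * l) ^ l * (2 * K) ^ l          ≤⟨ *-monoˡ-≤ ((2 * K) ^ l) (bernoulli-half l) ⟩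
    2 * (1 + 2 * l) ^ l * (2 * K) ^ l      ≡⟨ *-assoc 2 ((1 + 2 * l) ^ l) ((2 * K) ^ l) ⟩
    2 * ((1 + 2 * l) ^ l * (2 * K) ^ l)    ≡⟨ cong (2 *_) (^-distribʳ-* (1 + 2 * l) (2 * K) l) ⟨
    2 * ((1 + 2 * l) * (2 * K)) ^ l        ≡⟨ cong (λ z → 2 * z ^ l) (eq l K) ⟩
    2 * (2 * B) ^ l                        ∎
    where
    eq : ∀ l K → (1 + 2 * l) * (2 * K) ≡ 2 * ((1 + 2 * l) * K)
    eq = solve-∀

  h≤4Y : h ≤ 4 * Y
  h≤4Y = begin
    h                            ≤⟨ n≤2*[n/d]*d h M (m*n≤o⇒m≤o/n 1 M h (subst (_≤ h) (sym (*-identityˡ M)) M≤h)) ⟩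
    2 * (Q * M)                  ≤⟨ *-monoʳ-≤ 2 (*-monoʳ-≤ Q M≤) ⟩
    2 * (Q * (2 * (2 * B) ^ l))  ≡⟨ eq Q ((2 * B) ^ l) ⟩
    4 * Y                        ∎
    where
    eq : ∀ q y → 2 * (q * (2 * y)) ≡ 4 * (q * y)
    eq = solve-∀

-- The lower bound for every large n

sum-replicate : ∀ m h → sum (replicate m h) ≡ m * h
sum-replicate zero    h = refl
sum-replicate (suc m) h = cong (h +_) (sum-replicate m h)

8n≤2^n : ∀ {n} → 6 ≤ n → 8 * n ≤ 2 ^ n
8n≤2^n 6≤n with t , refl ← m≤n⇒∃[o]m+o≡n 6≤n = go t
  where
  open ≤-Reasoning
  go : ∀ t → 8 * (6 + t) ≤ 2 ^ (6 + t)
  go zero    = m≤m+n 48 16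
  go (suc t) = begin
    8 * (6 + suc t)            ≡⟨ eq t ⟩
    8 * (6 + t) + 8            ≤⟨ +-mono-≤ (go t) (^-monoʳ-≤ 2 {3} {6 + t} (s≤s (s≤s (s≤s z≤n)))) ⟩
    2 ^ (6 + t) + 2 ^ (6 + t)  ≡⟨ cong (2 ^ (6 + t) +_) (+-identityʳ _) ⟨
    2 ^ (6 + suc t)            ∎
    where
    eq : ∀ t → 8 * (6 + suc t) ≡ 8 * (6 + t) + 8
    eq = solve-∀

-- Lowering s to l = s - δ makes room for the polynomial factor: 4(1 + l) 2^l ≤ 2^s, so the block
-- size of `Ex-S₀-dense` is at most 2^(sl). As l + 1 ≤ s, a further factor 2^s is left for dividing
-- n among the 2 + m axes.
Ex-S₀-growth : ∀ m l δ s n → δ + l ≡ s →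
  1 ≤ δ → 4 * s ≤ 2 ^ δ → 2 + m ≤ 2 ^ s → 2 ^ (s * s) ≤ n →
  2 ^ l * n ^ (1 + m) ≤ 4 * (2 * (2 + m)) ^ (1 + m) * Ex (matrixHypergraph S₀^[2+ m ]) n
Ex-S₀-growth m l δ s n δ+l≡s 1≤δ 4s≤2^δ ρ≤2^s 2^ss≤n = begin
  2 ^ l * n ^ (1 + m)                        ≤⟨ *-monoʳ-≤ (2 ^ l) (^-monoˡ-≤ (1 + m) n≤2rh) ⟩
  2 ^ l * (2 * ρ * h) ^ (1 + m)              ≡⟨ cong (2 ^ l *_) (^-distribʳ-* (2 * ρ) h (1 + m)) ⟩
  2 ^ l * ((2 * ρ) ^ (1 + m) * h ^ (1 + m))  ≡⟨ lemma (2 ^ l) ((2 * ρ) ^ (1 + m)) (h ^ (1 + m)) ⟩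
  (2 * ρ) ^ (1 + m) * (2 ^ l * h ^ (1 + m))  ≤⟨ *-monoʳ-≤ ((2 * ρ) ^ (1 + m)) (Ex-S₀-dense m l h R M≤h (m≤n+m h (n % ρ))) ⟩
  (2 * ρ) ^ (1 + m) * (4 * Ex H (sum (R ∷ h ∷ replicate m h)))
    ≡⟨ cong (λ z → (2 * ρ) ^ (1 + m) * (4 * Ex H z)) total ⟩
  (2 * ρ) ^ (1 + m) * (4 * Ex H n)           ≡⟨ lemma′ ((2 * ρ) ^ (1 + m)) (Ex H n) ⟩
  4 * (2 * ρ) ^ (1 + m) * Ex H n             ∎
  where
  open ≤-Reasoning
  H = matrixHypergraph S₀^[2+ m ]
  ρ = 2 + m
  h = n / ρ
  -- The first axis absorbs the remainder, so that the axes have exactly n vertices in total.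
  R = n % ρ + h

  lemma : ∀ a b c → a * (b * c) ≡ b * (a * c)
  lemma = solve-∀

  lemma′ : ∀ a b → a * (4 * b) ≡ 4 * a * b
  lemma′ = solve-∀

  total : sum (R ∷ h ∷ replicate m h) ≡ n
  total = begin-equality
    n % ρ + h + (h + sum (replicate m h))  ≡⟨ cong (λ z → n % ρ + h + (h + z)) (sum-replicate m h) ⟩
    n % ρ + h + (h + m * h)                ≡⟨ eq (n % ρ) h m ⟩
    n % ρ + h * ρ                          ≡⟨ m≡m%n+[m/n]*n n ρ ⟨
    n                                      ∎
    where
    eq : ∀ a h m → a + h + (h + m * h) ≡ a + h * (2 + m)
    eq = solve-∀

  1+l≤s : 1 + l ≤ s
  1+l≤s = subst (1 + l ≤_) δ+l≡s (+-monoˡ-≤ l 1≤δ)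

  base≤ : (2 + 2 * l) * (2 * 2 ^ l) ≤ 2 ^ s
  base≤ = begin
    (2 + 2 * l) * (2 * 2 ^ l)  ≡⟨ eq l (2 ^ l) ⟩
    4 * (1 + l) * 2 ^ l        ≤⟨ *-monoˡ-≤ (2 ^ l) (*-monoʳ-≤ 4 1+l≤s) ⟩
    4 * s * 2 ^ l              ≤⟨ *-monoˡ-≤ (2 ^ l) 4s≤2^δ ⟩
    2 ^ δ * 2 ^ l              ≡⟨ ^-distribˡ-+-* 2 δ l ⟨
    2 ^ (δ + l)                ≡⟨ cong (2 ^_) δ+l≡s ⟩
    2 ^ s                      ∎
    where
    eq : ∀ l K → (2 + 2 * l) * (2 * K) ≡ 4 * (1 + l) * K
    eq = solve-∀

  2^sl≤h : 2 ^ (s * l) ≤ h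
  2^sl≤h = m*n≤o⇒m≤o/n (2 ^ (s * l)) ρ n (begin
    2 ^ (s * l) * ρ      ≤⟨ *-monoʳ-≤ (2 ^ (s * l)) ρ≤2^s ⟩
    2 ^ (s * l) * 2 ^ s  ≡⟨ ^-distribˡ-+-* 2 (s * l) s ⟨
    2 ^ (s * l + s)      ≡⟨ cong (2 ^_) (trans (+-comm (s * l) s) (sym (*-suc s l))) ⟩
    2 ^ (s * suc l)      ≤⟨ ^-monoʳ-≤ 2 (*-monoʳ-≤ s 1+l≤s) ⟩
    2 ^ (s * s)          ≤⟨ 2^ss≤n ⟩
    n                    ∎)

  M≤h : ((2 + 2 * l) * (2 * 2 ^ l)) ^ l ≤ h
  M≤h = begin
    ((2 + 2 * l) * (2 * 2 ^ l)) ^ l  ≤⟨ ^-monoˡ-≤ l base≤ ⟩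
    (2 ^ s) ^ l                      ≡⟨ ^-*-assoc 2 s l ⟩
    2 ^ (s * l)                      ≤⟨ 2^sl≤h ⟩
    h                                ∎

  n≤2rh : n ≤ 2 * ρ * h
  n≤2rh = begin
    n            ≤⟨ n≤2*[n/d]*d n ρ (≤-trans (m^n>0 2 (s * l)) 2^sl≤h) ⟩
    2 * (h * ρ)  ≡⟨ eq h ρ ⟩
    2 * ρ * h    ∎
    where
    eq : ∀ h ρ → 2 * (h * ρ) ≡ 2 * ρ * h
    eq = solve-∀

-- Take δ = ⌊log s⌋ and lower s by 3 + δ. This offset satisfies 4s ≤ 2^(3+δ) ≤ 8s: the first
-- inequality is what `Ex-S₀-growth` asks for, and the second bounds the loss by 8s, which is the
-- O(log log n) in the exponent. The constant 32 is 8 times 4.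
Ex-S₀-√log : ∀ m s n → 8 + m ≤ s → 2 ^ (s * s) ≤ n →
  2 ^ s * n ^ (1 + m) ≤ 32 * (2 * (2 + m)) ^ (1 + m) * s * Ex (matrixHypergraph S₀^[2+ m ]) n
Ex-S₀-√log m s n 8+m≤s 2^ss≤n =
  let δ , 2^δ≤s , s<2^1+δ = crossing (2 ^_) n<2^n {s} (≤-trans (s≤s z≤n) 8+m≤s)
      l , 3+δ+l≡s = m≤n⇒∃[o]m+o≡n (3+δ≤s δ 2^δ≤s)
  in bound δ l 2^δ≤s s<2^1+δ 3+δ+l≡s
  where
  open ≤-Reasoning
  H = matrixHypergraph S₀^[2+ m ]
  c = (2 * (2 + m)) ^ (1 + m)

  3+δ≤s : ∀ δ → 2 ^ δ ≤ s → 3 + δ ≤ s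
  3+δ≤s δ 2^δ≤s = 2^-cancel-≤ (begin
    2 ^ (3 + δ)  ≡⟨ ^-distribˡ-+-* 2 3 δ ⟩
    8 * 2 ^ δ    ≤⟨ *-monoʳ-≤ 8 2^δ≤s ⟩
    8 * s        ≤⟨ 8n≤2^n (≤-trans (m≤m+n 6 (2 + m)) 8+m≤s) ⟩
    2 ^ s        ∎)

  r≤2^s : 2 + m ≤ 2 ^ s
  r≤2^s = ≤-trans (m≤n+m (2 + m) 6) (≤-trans 8+m≤s (<⇒≤ (n<2^n s)))

  lemma : ∀ s c e → 8 * s * (4 * c * e) ≡ 32 * c * s * e
  lemma = solve-∀

  bound : ∀ δ l → 2 ^ δ ≤ s → s < 2 ^ (1 + δ) → 3 + δ + l ≡ s →
          2 ^ s * n ^ (1 + m) ≤ 32 * c * s * Ex H n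
  bound δ l 2^δ≤s s<2^1+δ 3+δ+l≡s = begin
    2 ^ s * n ^ (1 + m)                ≡⟨ cong (λ z → 2 ^ z * n ^ (1 + m)) 3+δ+l≡s ⟨
    2 ^ (3 + δ + l) * n ^ (1 + m)      ≡⟨ cong (_* n ^ (1 + m)) (^-distribˡ-+-* 2 (3 + δ) l) ⟩
    2 ^ (3 + δ) * 2 ^ l * n ^ (1 + m)  ≡⟨ cong (λ z → z * 2 ^ l * n ^ (1 + m)) (^-distribˡ-+-* 2 3 δ) ⟩
    8 * 2 ^ δ * 2 ^ l * n ^ (1 + m)    ≤⟨ *-monoˡ-≤ (n ^ (1 + m)) (*-monoˡ-≤ (2 ^ l) (*-monoʳ-≤ 8 2^δ≤s)) ⟩
    8 * s * 2 ^ l * n ^ (1 + m)        ≡⟨ *-assoc (8 * s) (2 ^ l) (n ^ (1 + m)) ⟩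
    8 * s * (2 ^ l * n ^ (1 + m))      ≤⟨ *-monoʳ-≤ (8 * s) (Ex-S₀-growth m l (3 + δ) s n 3+δ+l≡s (s≤s z≤n) 4s≤ r≤2^s 2^ss≤n) ⟩
    8 * s * (4 * c * Ex H n)           ≡⟨ lemma s c (Ex H n) ⟩
    32 * c * s * Ex H n                ∎
    where
    4s≤ : 4 * s ≤ 2 ^ (3 + δ)
    4s≤ = begin
      4 * s            ≤⟨ *-monoʳ-≤ 4 (<⇒≤ s<2^1+δ) ⟩
      4 * 2 ^ (1 + δ)  ≡⟨ ^-distribˡ-+-* 2 2 (1 + δ) ⟨
      2 ^ (3 + δ)      ∎

s<2^ss : ∀ s → s < 2 ^ (s * s)
s<2^ss zero      = s≤s z≤n
s<2^ss s@(suc _) = <-≤-trans (n<2^n s) (^-monoʳ-≤ 2 (m≤m*n s s))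

*-cancel-square-≤ : ∀ {x y} → x * x ≤ y * y → x ≤ y
*-cancel-square-≤ le = ≮⇒≥ λ y<x → <⇒≱ (*-mono-< y<x y<x) le

-- With s = ⌊√(log n)⌋ we have 2^√(log n) ≤ 2^(s+1) and s ≤ log n.
√log-bound⇒Ω : ∀ k (f : ℕ → ℕ) D s₀ → 0 < D → 0 < s₀ →
  (∀ s n → s₀ ≤ s → 2 ^ (s * s) ≤ n → 2 ^ s * n ^ k ≤ D * s * f n) →
  Ω[n^ k ·2^√log-O[loglog]] f
√log-bound⇒Ω k f D s₀ 0<D 0<s₀ growth =
  -- One power of log n pays for the factor s, the 2 pays for rounding √(log n) up to s + 1, and the
  -- threshold forces s ≥ s₀.
  1 , 2 * D , 2 ^ (s₀ * s₀) , ≤-trans 0<D (m≤m+n D (D + 0)) ,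
  λ n n≥ p q a b _ _ p/q≤ log≤ →
    let s , 2^ss≤n , n< = crossing (λ s → 2 ^ (s * s)) s<2^ss (≤-trans (m^n>0 2 (s₀ * s₀)) n≥)
    in bound n n≥ p q a b p/q≤ log≤ s 2^ss≤n n<
  where
  open ≤-Reasoning

  bound : ∀ n → 2 ^ (s₀ * s₀) ≤ n → ∀ p q a b → 2 ^ (p * p) ≤ n ^ (q * q) → n ^ b ≤ 2 ^ a →
    ∀ s → 2 ^ (s * s) ≤ n → n < 2 ^ (suc s * suc s) →
    2 ^ p * (n ^ k * b ^ 1) ^ q ≤ (2 * D * a ^ 1 * f n) ^ q
  bound n n≥ p q a b p/q≤ log≤ s 2^ss≤n n< = begin
    2 ^ p * (n ^ k * b ^ 1) ^ q            ≤⟨ *-monoˡ-≤ _ (^-monoʳ-≤ 2 p≤) ⟩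
    2 ^ (suc s * q) * (n ^ k * b ^ 1) ^ q  ≡⟨ cong (_* (n ^ k * b ^ 1) ^ q) (^-*-assoc 2 (suc s) q) ⟨
    (2 ^ suc s) ^ q * (n ^ k * b ^ 1) ^ q  ≡⟨ ^-distribʳ-* (2 ^ suc s) (n ^ k * b ^ 1) q ⟨
    (2 ^ suc s * (n ^ k * b ^ 1)) ^ q      ≤⟨ ^-monoˡ-≤ q main ⟩
    (2 * D * a ^ 1 * f n) ^ q              ∎
    where
    s₀≤s : s₀ ≤ s
    s₀≤s = ≮⇒≥ λ s<s₀ → <⇒≱ n< (≤-trans (^-monoʳ-≤ 2 (*-mono-≤ s<s₀ s<s₀)) n≥)

    p≤ : p ≤ suc s * q
    p≤ = *-cancel-square-≤ (2^-cancel-≤ (begin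
      2 ^ (p * p)                      ≤⟨ p/q≤ ⟩
      n ^ (q * q)                      ≤⟨ ^-monoˡ-≤ (q * q) (<⇒≤ n<) ⟩
      (2 ^ (suc s * suc s)) ^ (q * q)  ≡⟨ ^-*-assoc 2 (suc s * suc s) (q * q) ⟩
      2 ^ (suc s * suc s * (q * q))    ≡⟨ cong (2 ^_) (eq (suc s) q) ⟩
      2 ^ (suc s * q * (suc s * q))    ∎))
      where
      eq : ∀ s q → s * s * (q * q) ≡ s * q * (s * q)
      eq = solve-∀

    sb≤a : s * b ≤ a
    sb≤a = 2^-cancel-≤ (begin
      2 ^ (s * b)        ≤⟨ ^-monoʳ-≤ 2 (*-monoˡ-≤ b (m≤m*n s s {{>-nonZero (≤-trans 0<s₀ s₀≤s)}})) ⟩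
      2 ^ (s * s * b)    ≡⟨ ^-*-assoc 2 (s * s) b ⟨
      (2 ^ (s * s)) ^ b  ≤⟨ ^-monoˡ-≤ b 2^ss≤n ⟩
      n ^ b              ≤⟨ log≤ ⟩
      2 ^ a              ∎)

    main : 2 ^ suc s * (n ^ k * b ^ 1) ≤ 2 * D * a ^ 1 * f n
    main = begin
      2 * 2 ^ s * (n ^ k * b ^ 1)  ≡⟨ eq₁ (2 ^ s) (n ^ k) b ⟩
      2 * b * (2 ^ s * n ^ k)      ≤⟨ *-monoʳ-≤ (2 * b) (growth s n s₀≤s 2^ss≤n) ⟩
      2 * b * (D * s * f n)        ≡⟨ eq₂ b D s (f n) ⟩
      2 * D * (s * b) * f n        ≤⟨ *-monoˡ-≤ (f n) (*-monoʳ-≤ (2 * D) sb≤a) ⟩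
      2 * D * a * f n              ≡⟨ cong (λ z → 2 * D * z * f n) (*-identityʳ a) ⟨
      2 * D * a ^ 1 * f n          ∎
      where
      eq₁ : ∀ u v b → 2 * u * (v * (b * 1)) ≡ 2 * b * (u * v)
      eq₁ = solve-∀
      eq₂ : ∀ b D s e → 2 * b * (D * s * e) ≡ 2 * D * (s * b) * e
      eq₂ = solve-∀

Ex-S₀-Ω : ∀ m → Ω[n^ 1 + m ·2^√log-O[loglog]] (Ex (matrixHypergraph S₀^[2+ m ]))
Ex-S₀-Ω m = √log-bound⇒Ω (1 + m) (Ex (matrixHypergraph S₀^[2+ m ]))
  (32 * (2 * (2 + m)) ^ (1 + m)) (8 + m)
  (*-mono-< {0} {32} {0} (s≤s z≤n) (m^n>0 (2 * (2 + m)) (1 + m))) (s≤s z≤n) (Ex-S₀-√log m)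

-- Incompatibility with polylogarithmic upper bounds

exponential-beats-linear : ∀ D E N → ∃[ j ] N ≤ j × D + j * E < 2 ^ j
-- For i at least D, 2E and N, the left side is at most i + i², which is below (i + 1)² ≤ (2^i)².
exponential-beats-linear D E N = i + i , ≤-trans (m≤n+m N (D + 2 * E)) (m≤m+n i i) , (begin-strict
  D + (i + i) * E        ≡⟨ cong (D +_) (eq i E) ⟩
  D + i * (2 * E)        ≤⟨ +-mono-≤ D≤i (*-monoʳ-≤ i 2E≤i) ⟩
  i + i * i              <⟨ +-monoˡ-< (i * i) (n<1+n i) ⟩
  suc i + i * i          ≤⟨ +-monoʳ-≤ (suc i) (*-monoʳ-≤ i (n≤1+n i)) ⟩
  suc i * suc i          ≤⟨ *-mono-≤ (n<2^n i) (n<2^n i) ⟩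
  2 ^ i * 2 ^ i          ≡⟨ ^-distribˡ-+-* 2 i i ⟨
  2 ^ (i + i)            ∎)
  where
  open ≤-Reasoning
  i = D + 2 * E + N
  D≤i : D ≤ i
  D≤i = ≤-trans (m≤m+n D (2 * E)) (m≤m+n _ N)
  2E≤i : 2 * E ≤ i
  2E≤i = ≤-trans (m≤n+m (2 * E) D) (m≤m+n _ N)
  eq : ∀ i E → (i + i) * E ≡ i * (2 * E)
  eq = solve-∀

-- The two bounds contradict each other at n = 2^(s²) with s = 2^j, where
-- √(log n) = s and log n = s² are exact.
Ω⇒¬O : ∀ k c (f : ℕ → ℕ) → Ω[n^ k ·2^√log-O[loglog]] f → ¬ O[n^ k ·log^ c ] f
Ω⇒¬O k c f (C , d , N , _ , lower) (K , N′ , upper)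
  -- Since L = 2^(2j), the polylogarithmic factor L^(C+c) is 2 to a power linear in j, and the
  -- constant d K is at most 2^(dK). Against them stands 2^s with s = 2^j.
  with j , N+N′≤j , D+jE<2^j ← exponential-beats-linear (d * K) (2 * (C + c)) (N + N′) =
  <⇒≱ (^-monoʳ-< 2 (s≤s (s≤s z≤n)) D+jE<2^j) (begin
    2 ^ s                                  ≤⟨ *-cancelʳ-≤ (2 ^ s) _ (n₀ ^ k) scaled ⟩
    d * K * (L ^ C * L ^ c)                ≤⟨ *-monoˡ-≤ (L ^ C * L ^ c) (<⇒≤ (n<2^n (d * K))) ⟩
    2 ^ (d * K) * (L ^ C * L ^ c)          ≡⟨ cong (2 ^ (d * K) *_) L^ ⟩
    2 ^ (d * K) * 2 ^ (j * (2 * (C + c)))  ≡⟨ ^-distribˡ-+-* 2 (d * K) _ ⟨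
    2 ^ (d * K + j * (2 * (C + c)))        ∎)
  where
  open ≤-Reasoning
  s = 2 ^ j
  L = s * s
  n₀ = 2 ^ L
  instance
    n₀^k≢0 : NonZero (n₀ ^ k)
    n₀^k≢0 = m^n≢0 n₀ k {{m^n≢0 2 L}}

  j≤n₀ : j ≤ n₀
  j≤n₀ = ≤-trans (<⇒≤ (n<2^n j)) (<⇒≤ (s<2^ss s))

  L^ : L ^ C * L ^ c ≡ 2 ^ (j * (2 * (C + c)))
  L^ = begin-equality
    L ^ C * L ^ c              ≡⟨ ^-distribˡ-+-* L C c ⟨
    L ^ (C + c)                ≡⟨ cong (_^ (C + c)) (^-distribˡ-+-* 2 j j) ⟨
    (2 ^ (j + j)) ^ (C + c)    ≡⟨ ^-*-assoc 2 (j + j) (C + c) ⟩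
    2 ^ ((j + j) * (C + c))    ≡⟨ cong (2 ^_) (eq j (C + c)) ⟩
    2 ^ (j * (2 * (C + c)))    ∎
    where
    eq : ∀ j e → (j + j) * e ≡ j * (2 * e)
    eq = solve-∀

  scaled : 2 ^ s * n₀ ^ k ≤ d * K * (L ^ C * L ^ c) * n₀ ^ k
  scaled = begin
    2 ^ s * n₀ ^ k                      ≡⟨ eq₁ ⟨
    2 ^ s * (n₀ ^ k * 1 ^ C) ^ 1        ≤⟨ lower n₀ (≤-trans (≤-trans (m≤m+n N N′) N+N′≤j) j≤n₀) s 1 L 1 (s≤s z≤n) (s≤s z≤n)
                                           (≤-reflexive (sym (^-identityʳ n₀))) (≤-reflexive (^-identityʳ n₀)) ⟩
    (d * L ^ C * f n₀) ^ 1              ≡⟨ ^-identityʳ _ ⟩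
    d * L ^ C * f n₀                    ≤⟨ *-monoʳ-≤ (d * L ^ C) fn≤ ⟩
    d * L ^ C * (K * n₀ ^ k * L ^ c)    ≡⟨ eq₂ d (L ^ C) K (n₀ ^ k) (L ^ c) ⟩
    d * K * (L ^ C * L ^ c) * n₀ ^ k    ∎
    where
    eq₁ : 2 ^ s * (n₀ ^ k * 1 ^ C) ^ 1 ≡ 2 ^ s * n₀ ^ k
    eq₁ = cong (2 ^ s *_) (trans (^-identityʳ _) (trans (cong (n₀ ^ k *_) (^-zeroˡ C)) (*-identityʳ _)))

    eq₂ : ∀ d x K y z → d * x * (K * y * z) ≡ d * K * (x * z) * y
    eq₂ = solve-∀

    fn≤ : f n₀ ≤ K * n₀ ^ k * L ^ c
    fn≤ = subst (_≤ K * n₀ ^ k * L ^ c) (trans (cong (f n₀ *_) (^-zeroˡ c)) (*-identityʳ (f n₀)))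
      (upper n₀ (≤-trans (≤-trans (m≤n+m N′ N) N+N′≤j) j≤n₀) L 1 (s≤s z≤n) (≤-reflexive (^-identityʳ n₀)))

mainTheorem5 :
    (m : ℕ) →
    let r = 2 + m
        H = matrixHypergraph S₀^[2+ m ]
    in
    IsForest H
    × HasIntervalChromaticNumber H r
    × Ω[n^ r ∸ 1 ·2^√log-O[loglog]] (Ex H)
    × ¬ (∀ {v} (F : Hypergraph r v) → IsForest F → HasIntervalChromaticNumber F r →
         ∃[ c ] O[n^ r ∸ 1 ·log^ c ] (Ex F))
-- The pattern hypergraph is itself the forest that violates every polylogarithmic bound.
mainTheorem5 m = S₀-forest m , χ≡r , Ex-S₀-Ω m , λ polylog →
  let c , bound = polylog H (S₀-forest m) χ≡r
  in Ω⇒¬O (1 + m) c (Ex H) (Ex-S₀-Ω m) bound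
  where
  H = matrixHypergraph S₀^[2+ m ]
  χ≡r = matrixHypergraph-intervalChromatic S₀^[2+ m ] (Fin.zero ∷ Fin.zero ∷ origin m) refl
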